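{- Let $F = G\circ F_m\circ\cdots\circ F_1:\mathbb{R}^{n_0}\to\mathbb{R}$ be a ReLU neural network of architecture $(n_0,\dots,n_m;1)$. For each $i\in\{1,\dots,m\}$, $\mathcal{C}(F_i\circ\cdots\circ F_1)$ is a polyhedral decomposition of $\mathbb{R}^{n_0}$ satisfying: (i) $F_i\circ\cdots\circ F_1$ is affine-linear on the cells of $\mathcal{C}(F_i\circ\cdots\circ F_1)$; (ii) $\bigcup_{k=1}^{i}\mathcal{B}_F^{(k)}$ is the domain (underlying set) of a polyhedral subcomplex of $\mathcal{C}(F_i\circ\cdots\circ F_1)$. In particular, $F$ is continuous and affine-linear on the cells of the polyhedral decomposition $\mathcal{C}(F)=\mathcal{C}(F_m\circ\cdots\circ F_1)$ of $\mathbb{R}^{n_0}$.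
   Context: **ReLU networks.** $\mathrm{ReLU}(x)=\max\{0,x\}$, and $\sigma:\mathbb{R}^n\to\mathbb{R}^n$ applies ReLU to each coordinate. A ReLU neural network of architecture $(n_0,\dots,n_m;1)$ (positive integers $n_0,\ldots,n_m$, $n_{m+1}=1$) is a sequence of affine maps $A_i:\mathbb{R}^{n_{i-1}}\to\mathbb{R}^{n_i}$, $i=1,\dots,m+1$; its layer maps are $F_i=\sigma\circ A_i$ for $i\le m$ and $G=A_{m+1}$, and the network map is $F=G\circ F_m\circ\cdots\circ F_1$. **Hyperplane arrangement of a layer.** Write $A_i(x)=Wx+b$. The $j$-th row gives the set $S_j=\{x: W_j\cdot x+b_j=0\}$. It is degenerate if $W_j=0$, and otherwise it is an affine hyperplane. The hyperplane arrangement $\mathcal{A}^{(i)}$ in $\mathbb{R}^{n_{i-1}}$ associated to $F_i$ is the finite set of the nondegenerate $S_j$. **Polyhedral complexes.** A polyhedral set is a finite intersection of closed affine half-spaces. Its faces are $\emptyset$, itself, and its intersections with supporting hyperplanes. A polyhedral complex is a finite set of polyhedral sets (cells) closed under taking faces and such that any two cells intersect in a common face. Its domain is the union of its cells. It is a polyhedral decomposition of $\mathbb{R}^n$ if its domain is $\mathbb{R}^n$. A subcomplex is a subset of the cells closed under taking faces. A map is affine-linear on cells if its restriction to each cell is affine-linear. A hyperplane arrangement $\mathcal{A}$ in $\mathbb{R}^n$ induces the polyhedral decomposition $\mathcal{C}(\mathcal{A})$ whose $n$-cells are the closures of the connected components of $\mathbb{R}^n\setminus\bigcup_{H\in\mathcal{A}}H$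 and whose other cells are the faces of these. **Level set complex.** If $M$ is a polyhedral complex, $f:|M|\to\mathbb{R}^r$ is affine-linear on cells of $M$, and $R$ is a polyhedral complex in $\mathbb{R}^r$, then $M_{\in R}:=\{S\cap f^{ -1}(Y): S\in M,\ Y\in R\}$. **Canonical complex.** Let $R^{(i)}=\mathcal{C}(\mathcal{A}^{(i)})$, a polyhedral decomposition of $\mathbb{R}^{n_{i-1}}$. Set $\mathcal{C}(F_1):=R^{(1)}$ and, for $i=2,\dots,m$, $\mathcal{C}(F_i\circ\cdots\circ F_1):=\mathcal{C}(F_{i-1}\circ\cdots\circ F_1)_{\in R^{(i)}}$, the level set complex with respect to the map $F_{i-1}\circ\cdots\circ F_1$. The canonical polyhedral complex of $F$ is $\mathcal{C}(F):=\mathcal{C}(F_m\circ\cdots\circ F_1)$. **Bent hyperplanes.** $\mathcal{B}_F^{(1)}=\bigcup_{H\in\mathcal{A}^{(1)}}H$, and for $2\le k\le m$, $\mathcal{B}_F^{(k)}=\bigcup_{H\in\mathcal{A}^{(k)}}(F_{k-1}\circ\cdots\circ F_1)^{ -1}(H)\subseteq\mathbb{R}^{n_0}$. -}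

module Defs where

open import Algebra.Bundles using (CommutativeRing)
open import Algebra.Structures using (IsCommutativeRing)
open import Data.Fin.Base using (Fin)
open import Data.List.Base using (List)
open import Data.List.Relation.Unary.All using (All)
open import Data.List.Relation.Unary.Any using (Any)
open import Data.Nat.Base as ℕ using (ℕ; zero; suc)
import Data.Nat.Properties as ℕ
open import Data.Product.Base using (Σ-syntax; ∃-syntax; _×_; _,_)
open import Data.Sum.Base using (_⊎_)
open import Data.Vec.Functional using (Vector)
open import Function.Base using (_∘_; id)
open import Function.Bundles using (_⇔_)
open import Level using (0ℓ) renaming (suc to lsuc)
open import Relation.Binary.Bundles using (TotalOrder)
open import Relation.Binary.Core using (Rel)
open import Relation.Binary.Structures using (IsTotalOrder)
import Algebra.Construct.NaturalChoice.Max as NaturalMax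
import Algebra.Definitions.RawMonoid as RawMonoidDefs
import Relation.Binary.Construct.NonStrictToStrict as ToStrict
open import Relation.Nullary.Negation.Core using (¬_)
open import Relation.Unary
  using (Pred; _∈_; _⊆_; _≐_; _∩_; _∪_; _⊢_; ∁; ∅; U; Satisfiable; ⋃)

-- Classically the real numbers are the unique complete ordered field.  The
-- equality is a setoid equality so that, given excluded middle, models
-- (e.g. Dedekind cuts ℚ → Bool) exist without function extensionality.

record CompleteOrderedField : Set₁ where
  infixl 7 _*_
  infixl 6 _+_
  infix  8 -_
  infix  4 _≈_ _≤_
  field
    Carrier           : Set
    _≈_               : Rel Carrier 0ℓ
    _≤_               : Rel Carrier 0ℓ
    _+_ _*_           : Carrier → Carrier → Carrier
    -_                : Carrier → Carrier
    0# 1#             : Carrier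
    isCommutativeRing : IsCommutativeRing _≈_ _+_ _*_ -_ 0# 1#
    0≉1               : ¬ 0# ≈ 1#
    inverse           : ∀ x → ¬ x ≈ 0# → ∃[ y ] x * y ≈ 1#
    isTotalOrder      : IsTotalOrder _≈_ _≤_
    +-monoˡ-≤         : ∀ {x y} z → x ≤ y → x + z ≤ y + z
    *-nonneg          : ∀ {x y} → 0# ≤ x → 0# ≤ y → 0# ≤ x * y
    supremum          : (P : Pred Carrier 0ℓ) → Satisfiable P →
                        (∃[ u ] ∀ x → P x → x ≤ u) →
                        ∃[ s ] (∀ x → P x → x ≤ s) ×
                               (∀ u → (∀ x → P x → x ≤ u) → s ≤ u)

  commutativeRing : CommutativeRing 0ℓ 0ℓ
  commutativeRing = record { isCommutativeRing = isCommutativeRing }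

  totalOrder : TotalOrder 0ℓ 0ℓ 0ℓ
  totalOrder = record { isTotalOrder = isTotalOrder }

  open CommutativeRing commutativeRing public
    using (_-_; +-rawMonoid)
  open ToStrict _≈_ _≤_ public using (_<_)
  open NaturalMax totalOrder public using (_⊔_)
  open RawMonoidDefs +-rawMonoid public using (sum)

module Euclidean (𝓡 : CompleteOrderedField) where
  open CompleteOrderedField 𝓡 renaming (Carrier to ℝ)

  ℝ^_ : ℕ → Set
  ℝ^ n = Vector ℝ n

  Subset : ℕ → Set₁
  Subset n = Pred (ℝ^ n) 0ℓ

  ----------------------------------------------------------------------
  -- Topology

  -- Balls of the sup-metric, which generate the usual topology.
  Near : ∀ {n} → ℝ → ℝ^ n → ℝ^ n → Set
  Near ε x y = ∀ i → (x i - y i < ε) × (y i - x i < ε)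

  Open : ∀ {n} → Subset n → Set
  Open P = ∀ x → x ∈ P → ∃[ ε ] 0# < ε × (∀ y → Near ε x y → y ∈ P)

  closure : ∀ {n} → Subset n → Subset n
  closure P x = ∀ ε → 0# < ε → ∃[ y ] Near ε x y × y ∈ P

  Continuous : ∀ {n k} → (ℝ^ n → ℝ^ k) → Set
  Continuous f = ∀ x ε → 0# < ε →
    ∃[ δ ] 0# < δ × (∀ y → Near δ x y → Near ε (f x) (f y))

  Connected : ∀ {n} → Subset n → Set₁
  Connected {n} C =
    (P Q : Subset n) → Open P → Open Q → C ⊆ P ∪ Q →
    Satisfiable (C ∩ P) → Satisfiable (C ∩ Q) → Satisfiable (C ∩ (P ∩ Q))

  record IsConnectedComponent {n} (X C : Subset n) : Set₁ where
    field
      contained : C ⊆ X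
      nonempty  : Satisfiable C
      connected : Connected C
      maximal   : (D : Subset n) → D ⊆ X → Connected D → C ⊆ D → D ⊆ C

  ----------------------------------------------------------------------
  -- Affine forms and affine maps

  infixl 7 _·_
  _·_ : ∀ {n} → ℝ^ n → ℝ^ n → ℝ
  v · w = sum (λ i → v i * w i)

  record AffineForm (n : ℕ) : Set where
    constructor affineForm
    field
      normal : ℝ^ n
      offset : ℝ

    eval : ℝ^ n → ℝ
    eval x = normal · x + offset

    Nondegenerate : Set
    Nondegenerate = ¬ (∀ i → normal i ≈ 0#)

    zeroSet : Subset n
    zeroSet x = eval x ≈ 0#

    halfSpace : Subset n
    halfSpace x = eval x ≤ 0#

  open AffineForm public

  record AffineMap (n k : ℕ) : Set where
    field
      W : Vector (ℝ^ n) k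
      b : ℝ^ k

    row : Fin k → AffineForm n
    row j = affineForm (W j) (b j)

    apply : ℝ^ n → ℝ^ k
    apply x j = eval (row j) x

  open AffineMap public

  ----------------------------------------------------------------------
  -- Polyhedral complexes

  IsPolyhedral : ∀ {n} → Subset n → Set
  IsPolyhedral {n} S = Σ[ hs ∈ List (AffineForm n) ]
    All Nondegenerate hs × S ≐ (λ x → All (λ h → x ∈ halfSpace h) hs)

  -- One side suffices: replacing h by its negative swaps the two sides.
  IsSupporting : ∀ {n} → AffineForm n → Subset n → Set
  IsSupporting h S =
    Nondegenerate h × S ⊆ halfSpace h × Satisfiable (S ∩ zeroSet h)

  IsFace : ∀ {n} → Subset n → Subset n → Set
  IsFace T S =
    T ≐ ∅ ⊎ T ≐ S ⊎ (∃[ h ] IsSupporting h S × T ≐ S ∩ zeroSet h)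

  -- A set of subsets of ℝ^ n.  Subsets are identified up to _≐_; any Cells
  -- closed under faces is closed under _≐_ because S ≐ T gives IsFace S T.
  Cells : ℕ → Set₂
  Cells n = Pred (Subset n) (lsuc 0ℓ)

  Finite : ∀ {n} → Cells n → Set₁
  Finite {n} K = Σ[ Ss ∈ List (Subset n) ] (∀ S → S ∈ K ⇔ Any (S ≐_) Ss)

  FaceClosed : ∀ {n} → Cells n → Set₁
  FaceClosed K = ∀ S T → S ∈ K → IsFace T S → T ∈ K

  record IsPolyhedralComplex {n} (K : Cells n) : Set₁ where
    field
      finite     : Finite K
      polyhedral : ∀ S → S ∈ K → IsPolyhedral S
      faceClosed : FaceClosed K
      commonFace : ∀ S T → S ∈ K → T ∈ K →
                   IsFace (S ∩ T) S × IsFace (S ∩ T) T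

  domain : ∀ {n} → Cells n → Pred (ℝ^ n) (lsuc 0ℓ)
  domain K x = ∃[ S ] S ∈ K × x ∈ S

  IsPolyhedralDecomposition : ∀ {n} → Cells n → Set₁
  IsPolyhedralDecomposition K = IsPolyhedralComplex K × domain K ≐ U

  IsSubcomplex : ∀ {n} → Cells n → Cells n → Set₁
  IsSubcomplex L K = L ⊆ K × FaceClosed L

  AffineOnCells : ∀ {n k} → Cells n → (ℝ^ n → ℝ^ k) → Set₁
  AffineOnCells {n} {k} K f = ∀ S → S ∈ K →
    Σ[ A ∈ AffineMap n k ] (∀ x → x ∈ S → ∀ j → f x j ≈ apply A x j)

  levelSetComplex : ∀ {n r} → Cells n → (ℝ^ n → ℝ^ r) → Cells r → Cells n
  levelSetComplex M f R T =
    ∃[ S ] ∃[ Y ] S ∈ M × Y ∈ R × T ≐ S ∩ (f ⊢ Y)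

  ----------------------------------------------------------------------
  -- Hyperplane arrangements

  record Arrangement (n : ℕ) : Set₁ where
    field
      Index      : Set
      hyperplane : Index → Subset n

    support : Subset n
    support = ⋃[ j ∶ Index ] hyperplane j

  open Arrangement public

  -- Every polyhedral set is a face of itself, so this includes the n-cells.
  induced : ∀ {n} → Arrangement n → Cells n
  induced 𝓐 T =
    ∃[ C ] IsConnectedComponent (∁ (support 𝓐)) C × IsFace T (closure C)

  layerArrangement : ∀ {n k} → AffineMap n k → Arrangement n
  layerArrangement {k = k} A = record
    { Index      = Σ[ j ∈ Fin k ] Nondegenerate (row A j)
    ; hyperplane = λ (j , _) → zeroSet (row A j)
    }

  ----------------------------------------------------------------------
  -- ReLU networks

  σ : ∀ {n} → ℝ^ n → ℝ^ n
  σ x i = 0# ⊔ x i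

  -- Architecture (width 0, …, width m; 1) with m = suc d ≥ 1 hidden layers.
  -- Affine maps are indexed from zero: A j is the map usually called A_{j+1}.
  -- Values of width beyond m are unused.
  record Network : Set where
    field
      d         : ℕ

    m : ℕ
    m = suc d

    field
      width     : ℕ → ℕ
      width-pos : ∀ i → i ℕ.≤ m → 0 ℕ.< width i
      A         : ∀ j → .(j ℕ.< m) → AffineMap (width j) (width (suc j))
      G         : AffineMap (width m) 1

    layer : ∀ j → .(j ℕ.< m) → ℝ^ width j → ℝ^ width (suc j)
    layer j j<m = σ ∘ apply (A j j<m)

    -- The composite of the first i layer maps.
    composite : ∀ i → .(i ℕ.≤ m) → ℝ^ width 0 → ℝ^ width i
    composite zero    _   = id
    composite (suc j) j<m = layer j j<m ∘ composite j (ℕ.<⇒≤ j<m)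

    network : ℝ^ width 0 → ℝ^ 1
    network = apply G ∘ composite m ℕ.≤-refl

    𝓐 : ∀ j → .(j ℕ.< m) → Arrangement (width j)
    𝓐 j j<m = layerArrangement (A j j<m)

    -- The complex of the composite of the first suc j layer maps.
    complex : ∀ j → .(j ℕ.< m) → Cells (width 0)
    complex zero    0<m = induced (𝓐 0 0<m)
    complex (suc j) j<m =
      levelSetComplex (complex j (ℕ.<⇒≤ j<m))
                      (composite (suc j) (ℕ.<⇒≤ j<m))
                      (induced (𝓐 (suc j) j<m))

    canonicalComplex : Cells (width 0)
    canonicalComplex = complex d ℕ.≤-refl

    -- For j = 0 the composite is the identity, and this is the union of the
    -- hyperplanes of the first layer.
    bent : ∀ j → .(j ℕ.< m) → Subset (width 0)
    bent j j<m =
      ⋃[ h ∶ Index (𝓐 j j<m) ]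
        (composite j (ℕ.<⇒≤ j<m) ⊢ hyperplane (𝓐 j j<m) h)

    bentUpTo : ∀ j → .(j ℕ.< m) → Subset (width 0)
    bentUpTo j j<m x =
      ∃[ k ] Σ[ k≤j ∈ k ℕ.≤ j ] x ∈ bent k (ℕ.≤-<-trans k≤j j<m)

{-# OPTIONS --safe #-}
module Submission where

-- Call a point y of sign type at most s if every preactivation at y is zero or
-- has the sign prescribed by s.  Where the signs of all preactivations of the
-- first i layers are prescribed in this weak sense, each ReLU is either linear or
-- zero, so by induction every preactivation is affine there, and the region is
-- a polyhedron.  The complex of the first i layers consists of these regions
-- together with ∅.  A nonempty region (or a face of it) contains a point w at
-- which as few preactivations as possible vanish, and it is then the region of
-- the sign vector of w; hence faces are cells.  The intersection of two cells is
-- a face because the forms whose prescribed signs differ, suitably oriented, are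
-- nonnegative on the cell, and their sum vanishes exactly where all of them do.
-- For a single layer, connected components of the complement of the hyperplanes
-- are the chambers of constant strict sign, since these are convex, and every
-- region is a face of the closure of the chamber of a generic point near w.

open import Defs
open import Algebra.Bundles using (CommutativeRing; RawRing)
import Algebra.Construct.NaturalChoice.Max as NaturalMax
open import Algebra.Construct.NaturalChoice.Base using (MaxOperator)
import Algebra.Properties.Ring as RingProperties
import Algebra.Properties.Semiring.Mult.TCOptimised as SemiringMult
import Algebra.Solver.Ring as RingSolver
open import Algebra.Solver.Ring.AlmostCommutativeRing
  using (fromCommutativeRing; _-Raw-AlmostCommutative⟶_)
open import Axiom.ExcludedMiddle using (ExcludedMiddle)
open import Data.Empty using (⊥-elim)
open import Data.Fin.Base using (Fin; zero; suc)
open import Data.Integer.Base as ℤ using (ℤ; 0ℤ; 1ℤ)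
import Data.Integer.Properties as ℤ
open import Data.List.Base as List using (List; []; _∷_; _++_; allFin; concatMap)
import Data.List.Membership.Propositional as List
open import Data.List.Membership.Propositional.Properties
  using (∈-allFin; ∈-map⁺; ∈-++⁺ˡ; ∈-++⁺ʳ)
open import Data.List.Relation.Unary.All as All using (All; []; _∷_)
import Data.List.Relation.Unary.All.Properties as All
open import Data.List.Relation.Unary.Any as Any using (Any; here; there)
import Data.List.Relation.Unary.Any.Properties as Any
import Data.Maybe.Base as Maybe
open import Data.Nat.Base as ℕ using (ℕ; zero; suc)
import Data.Nat.Properties as ℕ
open import Data.Product.Base as Product
  using (_×_; Σ-syntax; ∃-syntax; _,_; proj₁; proj₂)
import Data.Sign.Base as Sign
open import Data.Sum.Base using (_⊎_; inj₁; inj₂; [_,_]′)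
open import Data.Unit.Base using (tt)
open import Data.Vec.Functional using (Vector; head; tail)
import Data.Vec.Functional as Vector
open import Function.Base using (_∘_; id)
open import Function.Bundles using (mk⇔; Equivalence)
open import Level using (0ℓ)
import Relation.Binary.Construct.NonStrictToStrict as ToStrict
open import Relation.Binary.PropositionalEquality as ≡ using (_≡_)
open import Relation.Binary.Structures using (IsTotalOrder)
open import Relation.Nullary.Decidable
  using (Dec; yes; no; dec⇒maybe; decidable-stable)
open import Relation.Nullary.Negation using (¬_; contradiction)
open import Relation.Unary
  using (Pred; _∈_; _⊆_; _≐_; _∩_; _∪_; ∁; ∅; U; Satisfiable)
open import Relation.Unary.Properties using (≐-refl; ≐-sym; ≐-trans)

-- Ring solver with integer coefficients.

module IntegerRingSolver {c ℓ} (R : CommutativeRing c ℓ) where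
  open CommutativeRing R
  open RingProperties ring
    using (-0#≈0#; -‿distribˡ-*; -‿distribʳ-*; -‿involutive; -‿+-comm)
  open SemiringMult semiring using (×-homo-+; ×1-homo-*; 1+×) renaming (_×_ to _×ᵤ_)
  open import Relation.Binary.Reasoning.Setoid setoid

  fromℕ : ℕ → Carrier
  fromℕ n = n ×ᵤ 1#

  fromℤ : ℤ → Carrier
  fromℤ (ℤ.+ n)      = fromℕ n
  fromℤ (ℤ.-[1+ n ]) = - fromℕ (suc n)

  private
    cancel-suc : ∀ a b → a - b ≈ (1# + a) - (1# + b)
    cancel-suc a b = sym (begin
      (1# + a) - (1# + b)      ≈⟨ +-cong (+-comm 1# a) (sym (-‿+-comm 1# b)) ⟩
      (a + 1#) + (- 1# + - b)  ≈⟨ +-assoc a 1# _ ⟩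
      a + (1# + (- 1# + - b))  ≈⟨ +-congˡ (+-assoc 1# (- 1#) (- b)) ⟨
      a + ((1# - 1#) - b)      ≈⟨ +-congˡ (+-congʳ (-‿inverseʳ 1#)) ⟩
      a + (0# - b)             ≈⟨ +-congˡ (+-identityˡ (- b)) ⟩
      a - b                    ∎)

    fromℤ-⊖ : ∀ m n → fromℤ (m ℤ.⊖ n) ≈ fromℕ m - fromℕ n
    fromℤ-⊖ m       zero    = sym (trans (+-congˡ -0#≈0#) (+-identityʳ _))
    fromℤ-⊖ zero    (suc n) = sym (+-identityˡ _)
    fromℤ-⊖ (suc m) (suc n) = begin
      fromℤ (suc m ℤ.⊖ suc n)    ≡⟨ ≡.cong fromℤ (ℤ.[1+m]⊖[1+n]≡m⊖n m n) ⟩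
      fromℤ (m ℤ.⊖ n)            ≈⟨ fromℤ-⊖ m n ⟩
      fromℕ m - fromℕ n          ≈⟨ cancel-suc _ _ ⟩
      (1# + fromℕ m) - (1# + fromℕ n) ≈⟨ +-cong (1+× m 1#) (-‿cong (1+× n 1#)) ⟨
      fromℕ (suc m) - fromℕ (suc n) ∎

    fromℤ-+ : ∀ i j → fromℤ (i ℤ.+ j) ≈ fromℤ i + fromℤ j
    fromℤ-+ (ℤ.+ m)      (ℤ.+ n)      = ×-homo-+ 1# m n
    fromℤ-+ (ℤ.+ m)      (ℤ.-[1+ n ]) = fromℤ-⊖ m (suc n)
    fromℤ-+ (ℤ.-[1+ m ]) (ℤ.+ n)      =
      trans (fromℤ-⊖ n (suc m)) (+-comm _ _)
    fromℤ-+ (ℤ.-[1+ m ]) (ℤ.-[1+ n ]) = begin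
      - fromℕ (suc (suc (m ℕ.+ n)))     ≡⟨ ≡.cong (λ k → - fromℕ (suc k)) (ℕ.+-suc m n) ⟨
      - fromℕ (suc m ℕ.+ suc n)         ≈⟨ -‿cong (×-homo-+ 1# (suc m) (suc n)) ⟩
      - (fromℕ (suc m) + fromℕ (suc n)) ≈⟨ -‿+-comm _ _ ⟨
      - fromℕ (suc m) - fromℕ (suc n)   ∎

    fromℤ-pos◃ : ∀ n → fromℤ (Sign.+ ℤ.◃ n) ≈ fromℕ n
    fromℤ-pos◃ zero    = refl
    fromℤ-pos◃ (suc n) = refl

    fromℤ-neg◃ : ∀ n → fromℤ (Sign.- ℤ.◃ n) ≈ - fromℕ n
    fromℤ-neg◃ zero    = sym -0#≈0#
    fromℤ-neg◃ (suc n) = refl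

    fromℤ-* : ∀ i j → fromℤ (i ℤ.* j) ≈ fromℤ i * fromℤ j
    fromℤ-* (ℤ.+ m) (ℤ.+ n) =
      trans (fromℤ-pos◃ (m ℕ.* n)) (×1-homo-* m n)
    fromℤ-* (ℤ.+ m) (ℤ.-[1+ n ]) =
      trans (fromℤ-neg◃ (m ℕ.* suc n))
            (trans (-‿cong (×1-homo-* m (suc n))) (-‿distribʳ-* _ _))
    fromℤ-* (ℤ.-[1+ m ]) (ℤ.+ n) =
      trans (fromℤ-neg◃ (suc m ℕ.* n))
            (trans (-‿cong (×1-homo-* (suc m) n)) (-‿distribˡ-* _ _))
    fromℤ-* (ℤ.-[1+ m ]) (ℤ.-[1+ n ]) = begin
      fromℤ (Sign.+ ℤ.◃ suc m ℕ.* suc n)  ≈⟨ fromℤ-pos◃ (suc m ℕ.* suc n) ⟩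
      fromℕ (suc m ℕ.* suc n)             ≈⟨ ×1-homo-* (suc m) (suc n) ⟩
      fromℕ (suc m) * fromℕ (suc n)       ≈⟨ -‿involutive _ ⟨
      - - (fromℕ (suc m) * fromℕ (suc n)) ≈⟨ -‿cong (-‿distribˡ-* _ _) ⟩
      - (- fromℕ (suc m) * fromℕ (suc n)) ≈⟨ -‿distribʳ-* _ _ ⟩
      - fromℕ (suc m) * - fromℕ (suc n)   ∎

    fromℤ-neg : ∀ i → fromℤ (ℤ.- i) ≈ - fromℤ i
    fromℤ-neg (ℤ.+ zero)   = sym -0#≈0#
    fromℤ-neg (ℤ.+ suc n)  = refl
    fromℤ-neg (ℤ.-[1+ n ]) = sym (-‿involutive _)

    ℤ-rawRing : RawRing _ _
    ℤ-rawRing = CommutativeRing.rawRing ℤ.+-*-commutativeRing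

    homomorphism : ℤ-rawRing -Raw-AlmostCommutative⟶ fromCommutativeRing R
    homomorphism = record
      { ⟦_⟧    = fromℤ
      ; +-homo = fromℤ-+
      ; *-homo = fromℤ-*
      ; -‿homo = fromℤ-neg
      ; 0-homo = refl
      ; 1-homo = refl
      }

  -- Equality of coefficients is decided in ℤ and then carried to `R` by `fromℤ`.
  open RingSolver ℤ-rawRing (fromCommutativeRing R) homomorphism
    (λ i j → Maybe.map (reflexive ∘ ≡.cong fromℤ) (dec⇒maybe (i ℤ.≟ j))) public
    using (solve; _:=_; _:+_; _:*_; _:-_; :-_; con)

-- Ordered-field arithmetic with excluded middle.

module ClassicalField
  (em : ∀ {ℓ} → ExcludedMiddle ℓ) (𝓡 : CompleteOrderedField) where

  open CompleteOrderedField 𝓡 renaming (Carrier to ℝ) public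
  open CommutativeRing commutativeRing public
    using (refl; sym; trans; +-cong; +-congˡ; +-congʳ; *-cong; *-congˡ; *-congʳ;
           -‿cong; +-identityˡ; +-identityʳ; *-identityˡ; zeroˡ; zeroʳ;
           +-comm; *-comm; -‿inverseʳ)
  open IntegerRingSolver commutativeRing public using (solve; _:=_; _:+_; _:*_; _:-_; :-_; con)
  open IsTotalOrder isTotalOrder public
    using (antisym; total; ≤-respˡ-≈; ≤-respʳ-≈)
    renaming (refl to ≤-refl; reflexive to ≤-reflexive; trans to ≤-trans)

  byContradiction : ∀ {a} {P : Set a} → ¬ ¬ P → P
  byContradiction = decidable-stable em

  ≤⇒0≤- : ∀ {x y} → x ≤ y → 0# ≤ y - x
  ≤⇒0≤- {x} {y} x≤y = ≤-respˡ-≈ (-‿inverseʳ x) (+-monoˡ-≤ (- x) x≤y)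

  0≤-⇒≤ : ∀ {x y} → 0# ≤ y - x → x ≤ y
  0≤-⇒≤ {x} {y} 0≤ = ≤-respˡ-≈ (+-identityˡ x)
    (≤-respʳ-≈ (solve 2 (λ x y → (y :- x) :+ x := y) refl x y) (+-monoˡ-≤ x 0≤))

  -≈0⇒≈ : ∀ {x y} → y - x ≈ 0# → x ≈ y
  -≈0⇒≈ {x} {y} e = sym (trans (solve 2 (λ x y → y := x :+ (y :- x)) refl x y)
    (trans (+-congˡ e) (+-identityʳ x)))

  <⇒0<- : ∀ {x y} → x < y → 0# < y - x
  <⇒0<- (x≤y , x≉y) = ≤⇒0≤- x≤y , λ e → x≉y (-≈0⇒≈ (sym e))

  0<-⇒< : ∀ {x y} → 0# < y - x → x < y
  0<-⇒< {x} (0≤ , 0≉) = 0≤-⇒≤ 0≤ , λ e → 0≉ (trans (sym (-‿inverseʳ x)) (+-congʳ e))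

  <-respʳ-≈ : ∀ {x y z} → y ≈ z → x < y → x < z
  <-respʳ-≈ e (p , q) = ≤-respʳ-≈ e p , λ x≈z → q (trans x≈z (sym e))

  <-respˡ-≈ : ∀ {x y z} → y ≈ z → y < x → z < x
  <-respˡ-≈ e (p , q) = ≤-respˡ-≈ e p , λ x≈z → q (trans e x≈z)

  <-≤-trans : ∀ {x y z} → x < y → y ≤ z → x < z
  <-≤-trans = ToStrict.<-≤-trans _≈_ _≤_ sym ≤-trans antisym ≤-respʳ-≈

  <⇒≱ : ∀ {x y} → x < y → ¬ y ≤ x
  <⇒≱ = ToStrict.<⇒≱ _≈_ _≤_ antisym

  ≰⇒> : ∀ {x y} → ¬ x ≤ y → y < x
  ≰⇒> = ToStrict.≰⇒> _≈_ _≤_ sym ≤-reflexive total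

  +-nonneg : ∀ {x y} → 0# ≤ x → 0# ≤ y → 0# ≤ x + y
  +-nonneg {x} {y} p q = ≤-trans q (≤-respˡ-≈ (+-identityˡ y) (+-monoˡ-≤ y p))

  +-nonneg-pos : ∀ {x y} → 0# ≤ x → 0# < y → 0# < x + y
  +-nonneg-pos {x} {y} p q = <-≤-trans q (≤-respˡ-≈ (+-identityˡ y) (+-monoˡ-≤ y p))

  +-pos-nonneg : ∀ {x y} → 0# < x → 0# ≤ y → 0# < x + y
  +-pos-nonneg p q = <-respʳ-≈ (+-comm _ _) (+-nonneg-pos q p)

  +-nonneg-≈0 : ∀ {x y} → 0# ≤ x → 0# ≤ y → x + y ≈ 0# → x ≈ 0#
  +-nonneg-≈0 p q e = byContradiction λ x≉0 →
    proj₂ (+-pos-nonneg (p , x≉0 ∘ sym) q) (sym e)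

  ≤0⇒0≤- : ∀ {x} → x ≤ 0# → 0# ≤ - x
  ≤0⇒0≤- p = ≤-respʳ-≈ (+-identityˡ _) (≤⇒0≤- p)

  0≤-⇒≤0 : ∀ {x} → 0# ≤ - x → x ≤ 0#
  0≤-⇒≤0 p = 0≤-⇒≤ (≤-respʳ-≈ (sym (+-identityˡ _)) p)

  -≈0 : ∀ {x} → x ≈ 0# → - x ≈ 0#
  -≈0 {x} e = trans (-‿cong e) (solve 0 (:- con 0ℤ := con 0ℤ) refl)

  -≈0⁻¹ : ∀ {x} → - x ≈ 0# → x ≈ 0#
  -≈0⁻¹ {x} e = trans (solve 1 (λ x → x := :- (:- x)) refl x) (-≈0 e)

  integral : ∀ {x y} → ¬ x ≈ 0# → x * y ≈ 0# → y ≈ 0#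
  integral {x} {y} x≉0 e = let z , xz≈1 = inverse x x≉0 in
    trans (sym (*-identityˡ y)) (trans (*-congʳ (sym xz≈1))
      (trans (solve 3 (λ x y z → (x :* z) :* y := z :* (x :* y)) refl x y z)
        (trans (*-congˡ e) (zeroʳ z))))

  *-pos : ∀ {x y} → 0# < x → 0# < y → 0# < x * y
  *-pos (p , x≉0) (q , y≉0) =
    *-nonneg p q , λ e → y≉0 (sym (integral (x≉0 ∘ sym) (sym e)))

  0<1 : 0# < 1#
  0<1 = nonneg (total 0# 1#) , 0≉1
    where
    nonneg : 0# ≤ 1# ⊎ 1# ≤ 0# → 0# ≤ 1#
    nonneg (inj₁ p) = p
    -- If 1 ≤ 0, then -1 is nonnegative, and so is its square, which is 1.
    nonneg (inj₂ p) = ≤-respʳ-≈ (solve 0 (:- con 1ℤ :* :- con 1ℤ := con 1ℤ) refl)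
      (*-nonneg (≤0⇒0≤- p) (≤0⇒0≤- p))

  inverse-pos : ∀ {x} → 0# < x → ∃[ y ] 0# < y × x * y ≈ 1#
  inverse-pos {x} (0≤x , 0≉x) with inverse x (0≉x ∘ sym)
  ... | y , xy≈1 = y , (0≤y (total 0# y) , 0≉y) , xy≈1
    where
    0≉y : ¬ 0# ≈ y
    0≉y e = 0≉1 (trans (sym (zeroʳ x)) (trans (*-congˡ e) xy≈1))
    0≤y : 0# ≤ y ⊎ y ≤ 0# → 0# ≤ y
    0≤y (inj₁ p) = p
    0≤y (inj₂ p) = contradiction (0≤-⇒≤0 (≤-respʳ-≈
      (trans (solve 2 (λ x y → x :* :- y := :- (x :* y)) refl x y) (-‿cong xy≈1))
      (*-nonneg 0≤x (≤0⇒0≤- p)))) (<⇒≱ 0<1)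

  0<2 : 0# < 1# + 1#
  0<2 = +-pos-nonneg 0<1 (proj₁ 0<1)

  ½ : ℝ
  ½ = proj₁ (inverse-pos 0<2)

  0<½ : 0# < ½
  0<½ = proj₁ (proj₂ (inverse-pos 0<2))

  ½+½≈1 : ½ + ½ ≈ 1#
  ½+½≈1 = trans (solve 1 (λ h → h :+ h := (con 1ℤ :+ con 1ℤ) :* h) refl ½)
    (proj₂ (proj₂ (inverse-pos 0<2)))

  ½≤1 : ½ ≤ 1#
  ½≤1 = 0≤-⇒≤ (≤-respʳ-≈
    (trans (solve 1 (λ h → h := (h :+ h) :- h) refl ½) (+-congʳ ½+½≈1)) (proj₁ 0<½))

  -- Perturbation arguments are phrased with this filter so that finitely many smallness conditions
  -- can be imposed at once, by `Eventually-×` and `Eventually-All`.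
  Eventually : (ℝ → Set) → Set
  Eventually P = ∃[ ε ] 0# < ε × (∀ δ → 0# < δ → δ ≤ ε → P δ)

  Eventually-witness : ∀ {P} → Eventually P → ∃[ δ ] 0# < δ × P δ
  Eventually-witness (ε , 0<ε , f) = ε , 0<ε , f ε 0<ε ≤-refl

  Eventually-map : ∀ {P Q : ℝ → Set} → (∀ {δ} → 0# < δ → P δ → Q δ) →
                   Eventually P → Eventually Q
  Eventually-map g (ε , 0<ε , f) = ε , 0<ε , λ δ 0<δ δ≤ε → g 0<δ (f δ 0<δ δ≤ε)

  Eventually-× : ∀ {P Q} → Eventually P → Eventually Q → Eventually (λ δ → P δ × Q δ)
  Eventually-× (ε , 0<ε , f) (ε′ , 0<ε′ , g) with total ε ε′
  ... | inj₁ ε≤ε′ = ε , 0<ε , λ δ p q → f δ p q , g δ p (≤-trans q ε≤ε′)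
  ... | inj₂ ε′≤ε = ε′ , 0<ε′ , λ δ p q → f δ p (≤-trans q ε′≤ε) , g δ p q

  Eventually-All : ∀ {A : Set} {P : A → ℝ → Set} (xs : List A) →
                   (∀ x → Eventually (P x)) →
                   Eventually (λ δ → All (λ x → P x δ) xs)
  Eventually-All []       f = 1# , 0<1 , λ _ _ _ → []
  Eventually-All (x ∷ xs) f =
    Eventually-map (λ _ (p , ps) → p ∷ ps) (Eventually-× (f x) (Eventually-All xs f))

  Eventually-≤ : ∀ {ε} → 0# < ε → Eventually (_≤ ε)
  Eventually-≤ {ε} 0<ε = ε , 0<ε , λ _ _ p → p

  Eventually-pos : ∀ {a} → 0# < a → ∀ c → Eventually (λ δ → 0# < a + δ * c)
  Eventually-pos {a} 0<a c with total 0# c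
  ... | inj₁ 0≤c = 1# , 0<1 , λ δ 0<δ _ → +-pos-nonneg 0<a (*-nonneg (proj₁ 0<δ) 0≤c)
  ... | inj₂ c≤0 with inverse-pos (+-pos-nonneg 0<a (≤0⇒0≤- c≤0))
  -- Here `b` is 1 / (a - c). For `δ` at most a * b, the value a + δ * c is the sum of the
  -- nonnegative (a * b - δ) * (- c) and the positive a * (a * b).
  ...   | b , 0<b , eq = a * b , *-pos 0<a 0<b , λ δ _ δ≤ →
    <-respʳ-≈ (trans
      (solve 4 (λ a b c δ → (a :* b :- δ) :* :- c :+ a :* (a :* b)
        := (a :* ((a :- c) :* b)) :+ δ :* c) refl a b c δ)
      (+-congʳ (trans (*-congˡ eq) (trans (*-comm a 1#) (*-identityˡ a)))))
    (+-nonneg-pos (*-nonneg (≤⇒0≤- δ≤) (≤0⇒0≤- c≤0)) (*-pos 0<a (*-pos 0<a 0<b)))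

  -- Strict and weak signs of real numbers.

  data Sgn : Set where
    neg zer pos : Sgn

  -- The negative case is positivity of `- x`, so that it reduces to the positive case by negation.
  Str : Sgn → ℝ → Set
  Str neg x = 0# < - x
  Str zer x = x ≈ 0#
  Str pos x = 0# < x

  Weak : Sgn → ℝ → Set
  Weak neg x = 0# ≤ - x
  Weak zer x = x ≈ 0#
  Weak pos x = 0# ≤ x

  -- Opaque, so that later proofs use a sign only through the proof that it is correct.
  abstract
    decideSgn : ∀ x → ∃[ s ] Str s x
    decideSgn x with em {P = x ≈ 0#} | total 0# x
    ... | yes x≈0 | _        = zer , x≈0
    ... | no  x≉0 | inj₁ 0≤x = pos , 0≤x , x≉0 ∘ sym
    ... | no  x≉0 | inj₂ x≤0 = neg , ≤0⇒0≤- x≤0 , λ e → x≉0 (-≈0⁻¹ (sym e))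

  sgn : ℝ → Sgn
  sgn = proj₁ ∘ decideSgn

  Str-sgn : ∀ x → Str (sgn x) x
  Str-sgn = proj₂ ∘ decideSgn

  Str-resp : ∀ s {x y} → x ≈ y → Str s x → Str s y
  Str-resp neg e p = <-respʳ-≈ (-‿cong e) p
  Str-resp zer e p = trans (sym e) p
  Str-resp pos e p = <-respʳ-≈ e p

  Weak-resp : ∀ s {x y} → x ≈ y → Weak s x → Weak s y
  Weak-resp neg e p = ≤-respʳ-≈ (-‿cong e) p
  Weak-resp zer e p = trans (sym e) p
  Weak-resp pos e p = ≤-respʳ-≈ e p

  Str⇒Weak : ∀ s {x} → Str s x → Weak s x
  Str⇒Weak neg p = proj₁ p
  Str⇒Weak zer p = p
  Str⇒Weak pos p = proj₁ p

  Weak-0 : ∀ s {x} → x ≈ 0# → Weak s x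
  Weak-0 neg e = ≤-reflexive (sym (-≈0 e))
  Weak-0 zer e = e
  Weak-0 pos e = ≤-reflexive (sym e)

  Str-0 : ∀ s {x y} → Str s x → Str s y → y ≈ 0# → x ≈ 0#
  Str-0 neg p q e = contradiction (sym (-≈0 e)) (proj₂ q)
  Str-0 zer p q e = p
  Str-0 pos p q e = contradiction (sym e) (proj₂ q)

  Weak-0≤-asym : ∀ {x} → 0# ≤ x → 0# ≤ - x → x ≈ 0#
  Weak-0≤-asym p q = antisym (0≤-⇒≤0 q) p

  -- If x is zero, then so is y, and zero satisfies every weak condition; a nonzero x satisfies only
  -- the weak condition of its own sign. Thus the strict sign of a number is the strongest weak
  -- condition on it.
  Str-Weak-mono : ∀ s t {x y} → Str s x → Weak t x → Weak s y → Weak t y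
  Str-Weak-mono neg neg p q r = r
  Str-Weak-mono neg zer p q r = contradiction (sym (-≈0 q)) (proj₂ p)
  Str-Weak-mono neg pos p q r =
    contradiction (sym (-≈0 (Weak-0≤-asym q (proj₁ p)))) (proj₂ p)
  Str-Weak-mono zer t   p q r = Weak-0 t r
  Str-Weak-mono pos neg p q r = contradiction (sym (Weak-0≤-asym (proj₁ p) q)) (proj₂ p)
  Str-Weak-mono pos zer p q r = contradiction (sym q) (proj₂ p)
  Str-Weak-mono pos pos p q r = r

  Weak-convex-pos : ∀ {x y t} → 0# ≤ t → t ≤ 1# → 0# ≤ x → 0# ≤ y →
                    0# ≤ x + t * (y - x)
  Weak-convex-pos {x} {y} {t} p q 0≤x 0≤y = ≤-respʳ-≈
    (solve 3 (λ x y t → (con 1ℤ :- t) :* x :+ t :* y := x :+ t :* (y :- x)) refl x y t)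
    (+-nonneg (*-nonneg (≤⇒0≤- q) 0≤x) (*-nonneg p 0≤y))

  private
    neg-convex : ∀ x y t → - x + t * (- y - - x) ≈ - (x + t * (y - x))
    neg-convex = solve 3 (λ x y t → :- x :+ t :* (:- y :- :- x) := :- (x :+ t :* (y :- x))) refl

    zer-convex : ∀ {x y} t → x ≈ 0# → y ≈ 0# → x + t * (y - x) ≈ 0#
    zer-convex t p q = trans (+-cong p (*-congˡ (+-cong q (-‿cong p))))
      (solve 1 (λ t → con 0ℤ :+ t :* (con 0ℤ :- con 0ℤ) := con 0ℤ) refl t)

  Weak-convex : ∀ s {x y t} → 0# ≤ t → t ≤ 1# → Weak s x → Weak s y →
                Weak s (x + t * (y - x))
  Weak-convex neg p q a b = ≤-respʳ-≈ (neg-convex _ _ _) (Weak-convex-pos p q a b)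
  Weak-convex zer {t = t} p q a b = zer-convex t a b
  Weak-convex pos p q a b = Weak-convex-pos p q a b

  Weak-Str-convex-pos : ∀ {x y t} → 0# < t → t ≤ 1# → 0# ≤ x → 0# < y →
                        0# < x + t * (y - x)
  Weak-Str-convex-pos {x} {y} {t} p q 0≤x 0<y = <-respʳ-≈
    (solve 3 (λ x y t → (con 1ℤ :- t) :* x :+ t :* y := x :+ t :* (y :- x)) refl x y t)
    (+-nonneg-pos (*-nonneg (≤⇒0≤- q) 0≤x) (*-pos p 0<y))

  -- In (1 - t) * x + t * y the second term already has the strict sign. Hence a segment from a
  -- closed region towards a point of its open chamber enters the chamber at once.
  Weak-Str-convex : ∀ s {x y t} → 0# < t → t ≤ 1# → Weak s x → Str s y →
                    Str s (x + t * (y - x))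
  Weak-Str-convex neg p q a b = <-respʳ-≈ (neg-convex _ _ _) (Weak-Str-convex-pos p q a b)
  Weak-Str-convex zer {t = t} p q a b = zer-convex t a b
  Weak-Str-convex pos p q a b = Weak-Str-convex-pos p q a b

  Str-convex : ∀ s {x y t} → 0# ≤ t → t ≤ 1# → Str s x → Str s y →
               Str s (x + t * (y - x))
  Str-convex s {x} {y} {t} 0≤t t≤1 p q with em {P = t ≈ 0#}
  ... | no  t≉0 = Weak-Str-convex s (0≤t , t≉0 ∘ sym) t≤1 (Str⇒Weak s p) q
  ... | yes t≈0 = Str-resp s (sym (trans (+-congˡ (*-congʳ t≈0))
      (solve 2 (λ x y → x :+ con 0ℤ :* (y :- x) := x) refl x y))) p

  -- A vanishing midpoint means x + y = 0, and two numbers of the same weak sign cancel only if both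
  -- are zero. This lets midpoints reduce the set of vanishing functions.
  Weak-midpoint-0 : ∀ s {x y} → Weak s x → Weak s y → x + ½ * (y - x) ≈ 0# →
                    x ≈ 0# × y ≈ 0#
  Weak-midpoint-0 s {x} {y} p q e = go s p q , trans (solve 2 (λ x y → y := (x :+ y) :- x) refl x y)
      (trans (+-cong sum≈0 (-≈0 (go s p q))) (+-identityˡ 0#))
    where
    sum≈0 : x + y ≈ 0#
    sum≈0 = integral (proj₂ 0<½ ∘ sym) (trans (trans
      (solve 3 (λ x y h → h :* (x :+ y) := (h :+ h) :* x :+ h :* (y :- x)) refl x y ½)
      (+-congʳ (trans (*-congʳ ½+½≈1) (*-identityˡ x)))) e)
    go : ∀ s → Weak s x → Weak s y → x ≈ 0#
    go neg p q = -≈0⁻¹ (+-nonneg-≈0 p q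
      (trans (solve 2 (λ x y → :- x :+ :- y := :- (x :+ y)) refl x y) (-≈0 sum≈0)))
    go zer p q = p
    go pos p q = +-nonneg-≈0 p q sum≈0

  -- Nonzero signs are stable under small changes; a zero is kept because the rate `c` is then zero
  -- by hypothesis.
  Eventually-Str : ∀ s {x} c → Str s x → (x ≈ 0# → c ≈ 0#) →
                   Eventually (λ δ → Str s (x + δ * c))
  Eventually-Str neg {x} c p _ = Eventually-map
    (λ {δ} _ → <-respʳ-≈ (solve 3 (λ x δ c → :- x :+ δ :* :- c := :- (x :+ δ :* c)) refl x δ c))
    (Eventually-pos p (- c))
  Eventually-Str zer c p f = 1# , 0<1 , λ δ _ _ →
    trans (+-cong p (trans (*-congˡ (f p)) (zeroʳ δ))) (+-identityˡ 0#)
  Eventually-Str pos c p _ = Eventually-pos p c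

  -- A nonzero x satisfies a single weak condition, so `t` must be `s`.
  Weak-Str-mono : ∀ s t {x y} → Str s x → ¬ x ≈ 0# → Weak t x → Weak t y → Weak s y
  Weak-Str-mono neg neg p x≉0 q r = r
  Weak-Str-mono neg pos p x≉0 q r = contradiction (Weak-0≤-asym q (proj₁ p)) x≉0
  Weak-Str-mono pos neg p x≉0 q r = contradiction (Weak-0≤-asym (proj₁ p) q) x≉0
  Weak-Str-mono pos pos p x≉0 q r = r
  Weak-Str-mono zer t   p x≉0 q r = contradiction p x≉0
  Weak-Str-mono neg zer p x≉0 q r = contradiction q x≉0
  Weak-Str-mono pos zer p x≉0 q r = contradiction q x≉0

  Str-unique : ∀ s t {x} → Str s x → Str t x → s ≡ t
  Str-unique neg neg p q = ≡.refl
  Str-unique neg zer p q = contradiction (sym (-≈0 q)) (proj₂ p)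
  Str-unique neg pos p q = contradiction (sym (Weak-0≤-asym (proj₁ q) (proj₁ p))) (proj₂ q)
  Str-unique zer neg p q = contradiction (sym (-≈0 p)) (proj₂ q)
  Str-unique zer zer p q = ≡.refl
  Str-unique zer pos p q = contradiction (sym p) (proj₂ q)
  Str-unique pos neg p q = contradiction (sym (Weak-0≤-asym (proj₁ p) (proj₁ q))) (proj₂ p)
  Str-unique pos zer p q = contradiction (sym q) (proj₂ p)
  Str-unique pos pos p q = ≡.refl

-- Affine forms, lines and composition.

module AffineForms
  (em : ∀ {ℓ} → ExcludedMiddle ℓ) (𝓡 : CompleteOrderedField) where

  open ClassicalField em 𝓡 public
  open Euclidean 𝓡 public

  private
    variable
      n k : ℕ

  Eventually-Fin : {P : Fin k → ℝ → Set} → (∀ i → Eventually (P i)) →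
                   Eventually (λ δ → ∀ i → P i δ)
  Eventually-Fin f = Eventually-map (λ _ ps i → All.lookup ps (∈-allFin i))
    (Eventually-All (allFin _) f)

  ·-cong : {v w x y : ℝ^ n} → (∀ i → v i ≈ w i) → (∀ i → x i ≈ y i) → v · x ≈ w · y
  ·-cong {zero}  p q = refl
  ·-cong {suc n} p q = +-cong (*-cong (p zero) (q zero)) (·-cong (p ∘ suc) (q ∘ suc))

  ·-zeroˡ : {v : ℝ^ n} (x : ℝ^ n) → (∀ i → v i ≈ 0#) → v · x ≈ 0#
  ·-zeroˡ {zero}  x p = refl
  ·-zeroˡ {suc n} x p =
    trans (+-cong (trans (*-congʳ (p zero)) (zeroˡ (x zero))) (·-zeroˡ (tail x) (p ∘ suc)))
          (+-identityˡ 0#)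

  eval-cong : (h : AffineForm n) {x y : ℝ^ n} → (∀ i → x i ≈ y i) → eval h x ≈ eval h y
  eval-cong h p = +-congʳ (·-cong (λ _ → refl) p)

  eval-degenerate : (h : AffineForm n) → ¬ Nondegenerate h → ∀ x y → eval h x ≈ eval h y
  eval-degenerate h ¬nd x y = +-congʳ
    (trans (·-zeroˡ x normal≈0) (sym (·-zeroˡ y normal≈0)))
    where
    normal≈0 : ∀ i → normal h i ≈ 0#
    normal≈0 = byContradiction ¬nd

  line : ℝ^ n → ℝ^ n → ℝ → ℝ^ n
  line x y t i = x i + t * (y i - x i)

  ·-line : (v x y : ℝ^ n) (t : ℝ) → v · line x y t ≈ v · x + t * (v · y - v · x)
  ·-line {zero}  v x y t = solve 1 (λ t → con 0ℤ := con 0ℤ :+ t :* (con 0ℤ :- con 0ℤ)) refl t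
  ·-line {suc n} v x y t = trans (+-congˡ (·-line (tail v) (tail x) (tail y) t))
    (solve 6 (λ v x y t a b → v :* (x :+ t :* (y :- x)) :+ (a :+ t :* (b :- a))
       := (v :* x :+ a) :+ t :* ((v :* y :+ b) :- (v :* x :+ a))) refl
       (v zero) (x zero) (y zero) t (tail v · tail x) (tail v · tail y))

  eval-line : (h : AffineForm n) (x y : ℝ^ n) (t : ℝ) →
              eval h (line x y t) ≈ eval h x + t * (eval h y - eval h x)
  eval-line h x y t = trans (+-congʳ (·-line (normal h) x y t))
    (solve 4 (λ t a b c → a :+ t :* (b :- a) :+ c
       := (a :+ c) :+ t :* ((b :+ c) :- (a :+ c))) refl
       t (normal h · x) (normal h · y) (offset h))

  constantForm : ℝ → AffineForm n
  constantForm c = affineForm (λ _ → 0#) c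

  eval-constantForm : ∀ c (x : ℝ^ n) → eval (constantForm c) x ≈ c
  eval-constantForm c x = trans (+-congʳ (·-zeroˡ x (λ _ → refl))) (+-identityˡ c)

  infixl 6 _⊕_
  infixr 7 _⊛_

  _⊕_ : AffineForm n → AffineForm n → AffineForm n
  g ⊕ h = affineForm (λ i → normal g i + normal h i) (offset g + offset h)

  _⊛_ : ℝ → AffineForm n → AffineForm n
  c ⊛ h = affineForm (λ i → c * normal h i) (c * offset h)

  eval-⊕ : (g h : AffineForm n) (x : ℝ^ n) → eval (g ⊕ h) x ≈ eval g x + eval h x
  eval-⊕ g h x = trans (+-congʳ (go (normal g) (normal h) x))
    (solve 4 (λ a b c d → (a :+ b) :+ (c :+ d) := (a :+ c) :+ (b :+ d)) refl
      (normal g · x) (normal h · x) (offset g) (offset h))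
    where
    go : ∀ {n} (v w x : ℝ^ n) → (λ i → v i + w i) · x ≈ v · x + w · x
    go {zero}  v w x = sym (+-identityˡ 0#)
    go {suc n} v w x = trans (+-congˡ (go (tail v) (tail w) (tail x)))
      (solve 5 (λ v w x a b → (v :+ w) :* x :+ (a :+ b) := (v :* x :+ a) :+ (w :* x :+ b)) refl
        (v zero) (w zero) (x zero) (tail v · tail x) (tail w · tail x))

  eval-⊛ : ∀ c (h : AffineForm n) (x : ℝ^ n) → eval (c ⊛ h) x ≈ c * eval h x
  eval-⊛ c h x = trans (+-congʳ (go (normal h) x))
    (solve 3 (λ a b c → a :* b :+ a :* c := a :* (b :+ c)) refl c (normal h · x) (offset h))
    where
    go : ∀ {n} (v x : ℝ^ n) → (λ i → c * v i) · x ≈ c * (v · x)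
    go {zero}  v x = sym (zeroʳ c)
    go {suc n} v x = trans (+-congˡ (go (tail v) (tail x)))
      (solve 4 (λ c v x a → (c :* v) :* x :+ c :* a := c :* (v :* x :+ a)) refl
        c (v zero) (x zero) (tail v · tail x))

  ⊖_ : AffineForm n → AffineForm n
  ⊖ h = (- 1#) ⊛ h

  eval-⊖ : (h : AffineForm n) (x : ℝ^ n) → eval (⊖ h) x ≈ - eval h x
  eval-⊖ h x = trans (eval-⊛ (- 1#) h x)
    (solve 1 (λ a → :- con 1ℤ :* a := :- a) refl (eval h x))

  ⊖-nondegenerate : (h : AffineForm n) → Nondegenerate h → Nondegenerate (⊖ h)
  ⊖-nondegenerate h nd e = nd λ i → -≈0⁻¹ (trans
    (solve 1 (λ a → :- a := :- con 1ℤ :* a) refl (normal h i)) (e i))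

  combination : ℝ^ k → Vector (AffineForm n) k → ℝ → AffineForm n
  combination {zero}  v a c = constantForm c
  combination {suc k} v a c = head v ⊛ head a ⊕ combination (tail v) (tail a) c

  eval-combination : (v : ℝ^ k) (a : Vector (AffineForm n) k) (c : ℝ) (x : ℝ^ n) →
                     eval (combination v a c) x ≈ v · (λ j → eval (a j) x) + c
  eval-combination {zero}  v a c x = trans (eval-constantForm c x) (sym (+-identityˡ c))
  eval-combination {suc k} v a c x =
    trans (eval-⊕ (head v ⊛ head a) (combination (tail v) (tail a) c) x)
    (trans (+-cong (eval-⊛ (head v) (head a) x) (eval-combination (tail v) (tail a) c x))
    (solve 3 (λ p q r → p :+ (q :+ r) := (p :+ q) :+ r) refl
      (head v * eval (head a) x) (tail v · (λ j → eval (tail a j) x)) c))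

  pullback : AffineForm k → AffineMap n k → AffineForm n
  pullback h A = combination (normal h) (row A) (offset h)

  eval-pullback : (h : AffineForm k) (A : AffineMap n k) (x : ℝ^ n) →
                  eval (pullback h A) x ≈ eval h (apply A x)
  eval-pullback h A = eval-combination (normal h) (row A) (offset h)

  fromRows : Vector (AffineForm n) k → AffineMap n k
  fromRows a = record { W = normal ∘ a ; b = offset ∘ a }

  ·-zeroʳ : (v : ℝ^ n) → v · (λ _ → 0#) ≈ 0#
  ·-zeroʳ {zero}  v = refl
  ·-zeroʳ {suc n} v = trans (+-cong (zeroʳ _) (·-zeroʳ (tail v))) (+-identityˡ 0#)

  -- The standard basis vector at the first nonzero coordinate of `v` serves.
  nonzero-direction : (v : ℝ^ n) → ¬ (∀ i → v i ≈ 0#) → ∃[ u ] ¬ v · u ≈ 0#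
  nonzero-direction {zero}  v nd = contradiction (λ ()) nd
  nonzero-direction {suc n} v nd with em {P = head v ≈ 0#}
  ... | no v≉0 = 1# Vector.∷ (λ _ → 0#) , λ e → v≉0 (trans
    (sym (trans (+-congˡ (·-zeroʳ (tail v)))
      (solve 1 (λ w → w :* con 1ℤ :+ con 0ℤ := w) refl (head v)))) e)
  ... | yes v≈0 with nonzero-direction (tail v) (λ e → nd λ { zero → v≈0 ; (suc i) → e i })
  ...   | u , p = 0# Vector.∷ u , λ e → p (trans
    (solve 2 (λ w a → a := w :* con 0ℤ :+ a) refl (head v) (tail v · u)) e)

  -- The origin works if the offset is nonzero; otherwise a vector not orthogonal to the normal
  -- does. Generic points are found by moving towards such points.
  nonzero-point : (h : AffineForm n) → Nondegenerate h → ∃[ y ] ¬ eval h y ≈ 0#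
  nonzero-point h nd with em {P = offset h ≈ 0#} | nonzero-direction (normal h) nd
  ... | no  c≉0 | _     = (λ _ → 0#) , λ e → c≉0 (trans
    (sym (trans (+-congʳ (·-zeroʳ (normal h))) (+-identityˡ _))) e)
  ... | yes c≈0 | u , p = u , λ e → p (trans
    (sym (trans (+-congˡ c≈0) (+-identityʳ _))) e)

-- Faces and polyhedral sets.

module SignSystems
  (em : ∀ {ℓ} → ExcludedMiddle ℓ) (𝓡 : CompleteOrderedField) where

  open AffineForms em 𝓡 public

  private
    variable
      n k : ℕ

  ∩-congˡ : {S S′ T : Subset n} → S ≐ S′ → S ∩ T ≐ S′ ∩ T
  ∩-congˡ (p , q) = Product.map₁ p , Product.map₁ q

  empty-≐∅ : {S : Subset n} → ¬ Satisfiable S → S ≐ ∅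
  empty-≐∅ ¬sat = (λ p → ¬sat (_ , p)) , λ ()

  IsFace-resp : {S S′ T T′ : Subset n} → S ≐ S′ → T ≐ T′ → IsFace T S → IsFace T′ S′
  IsFace-resp e f (inj₁ p)        = inj₁ (≐-trans (≐-sym f) p)
  IsFace-resp e f (inj₂ (inj₁ p)) = inj₂ (inj₁ (≐-trans (≐-sym f) (≐-trans p e)))
  IsFace-resp e f (inj₂ (inj₂ (h , (nd , below , x , x∈S , x∈h) , p))) =
    inj₂ (inj₂ (h , (nd , below ∘ proj₂ e , x , proj₁ e x∈S , x∈h) ,
      ≐-trans (≐-sym f) (≐-trans p (∩-congˡ e))))

  IsFace-⊆ : {S T : Subset n} → IsFace T S → T ⊆ S
  IsFace-⊆ (inj₁ p)                    x∈T = ⊥-elim (proj₁ p x∈T)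
  IsFace-⊆ (inj₂ (inj₁ p))             x∈T = proj₁ p x∈T
  IsFace-⊆ (inj₂ (inj₂ (_ , _ , p))) x∈T = proj₁ (proj₁ p x∈T)

  polyhedral-resp : {S T : Subset n} → S ≐ T → IsPolyhedral T → IsPolyhedral S
  polyhedral-resp e (hs , nd , p) = hs , nd , ≐-trans e p

  -- With t the sum of the coordinates, the conditions t ≤ -1 and t ≥ 1 contradict each other.
  -- Positive dimension is what makes these forms nondegenerate.
  polyhedral-∅ : 0 ℕ.< n → IsPolyhedral {n} ∅
  polyhedral-∅ {suc n} _ = g ∷ ⊖ h ∷ [] , nd ∷ ⊖-nondegenerate h nd ∷ [] ,
    (λ ()) , λ { {x} (p ∷ q ∷ []) → contradiction
      (≤-respʳ-≈ (trans (+-congˡ (-‿cong (eval-⊖ h x)))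
        (solve 1 (λ a → :- (a :+ con 1ℤ) :+ :- (:- (a :+ :- con 1ℤ)) := :- (con 1ℤ :+ con 1ℤ)) refl _))
        (+-nonneg (≤0⇒0≤- p) (≤0⇒0≤- q)))
      (λ 0≤-2 → <⇒≱ 0<2 (0≤-⇒≤0 0≤-2)) }
    where
    g h : AffineForm (suc n)
    g = affineForm (λ _ → 1#) 1#
    h = affineForm (λ _ → 1#) (- 1#)
    nd : Nondegenerate g
    nd e = 0≉1 (sym (e zero))

  -- Degenerate constraints are either vacuous or unsatisfiable.
  polyhedral-All : 0 ℕ.< n → (hs : List (AffineForm n)) →
                   IsPolyhedral (λ x → All (λ h → x ∈ halfSpace h) hs)
  polyhedral-All 0<n [] = [] , [] , (λ _ → []) , (λ _ → [])
  polyhedral-All 0<n (h ∷ hs) with em {P = Nondegenerate h} | polyhedral-All 0<n hs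
  ... | yes nd | ks , nds , p , q =
    h ∷ ks , nd ∷ nds , (λ { (a ∷ as) → a ∷ p as }) , λ { (a ∷ as) → a ∷ q as }
  ... | no ¬nd | ks , nds , p , q with em {P = Satisfiable (halfSpace h)}
  ...   | yes (y , y∈h) =
    ks , nds , (λ { (_ ∷ as) → p as }) ,
    λ as → ≤-respˡ-≈ (eval-degenerate h ¬nd _ _) y∈h ∷ q as
  ...   | no ¬sat = polyhedral-resp (empty-≐∅ λ { (x , a ∷ _) → ¬sat (x , a) }) (polyhedral-∅ 0<n)

  signConstraints : Sgn → AffineForm n → List (AffineForm n)
  signConstraints neg h = h ∷ []
  signConstraints zer h = h ∷ ⊖ h ∷ []
  signConstraints pos h = ⊖ h ∷ []

  Weak⇒signConstraints : ∀ s (h : AffineForm n) {x} → Weak s (eval h x) →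
                         All (λ g → x ∈ halfSpace g) (signConstraints s h)
  Weak⇒signConstraints neg h p = 0≤-⇒≤0 p ∷ []
  Weak⇒signConstraints zer h p =
    ≤-reflexive p ∷ ≤-reflexive (trans (eval-⊖ h _) (-≈0 p)) ∷ []
  Weak⇒signConstraints pos h p = 0≤-⇒≤0 (≤-respʳ-≈ (trans
    (solve 1 (λ a → a := :- (:- a)) refl _) (-‿cong (sym (eval-⊖ h _)))) p) ∷ []

  signConstraints⇒Weak : ∀ s (h : AffineForm n) {x} →
                         All (λ g → x ∈ halfSpace g) (signConstraints s h) →
                         Weak s (eval h x)
  signConstraints⇒Weak {n} s h {x} ps = go s ps
    where
    ⊖≤0⇒0≤ : eval (⊖ h) x ≤ 0# → 0# ≤ eval h x
    ⊖≤0⇒0≤ p = ≤-respʳ-≈ (trans (-‿cong (eval-⊖ h x))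
      (solve 1 (λ a → :- (:- a) := a) refl _)) (≤0⇒0≤- p)
    go : ∀ s → All (λ g → x ∈ halfSpace g) (signConstraints s h) → Weak s (eval h x)
    go neg (p ∷ [])     = ≤0⇒0≤- p
    go zer (p ∷ q ∷ []) = antisym p (⊖≤0⇒0≤ q)
    go pos (p ∷ [])     = ⊖≤0⇒0≤ p

  sumForm : List (AffineForm n) → AffineForm n
  sumForm = List.foldr _⊕_ (constantForm 0#)

  module _ {x : ℝ^ n} where

    sumForm-nonneg : ∀ gs → All (λ g → 0# ≤ eval g x) gs → 0# ≤ eval (sumForm gs) x
    sumForm-nonneg []       []       = ≤-reflexive (sym (eval-constantForm 0# x))
    sumForm-nonneg (g ∷ gs) (p ∷ ps) =
      ≤-respʳ-≈ (sym (eval-⊕ g (sumForm gs) x)) (+-nonneg p (sumForm-nonneg gs ps))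

    sumForm-≈0⇒ : ∀ gs → All (λ g → 0# ≤ eval g x) gs → eval (sumForm gs) x ≈ 0# →
                  All (λ g → eval g x ≈ 0#) gs
    sumForm-≈0⇒ []       []       e = []
    sumForm-≈0⇒ (g ∷ gs) (p ∷ ps) e =
      +-nonneg-≈0 p q e′ ∷ sumForm-≈0⇒ gs ps (+-nonneg-≈0 q p (trans (+-comm _ _) e′))
      where
      q = sumForm-nonneg gs ps
      e′ = trans (sym (eval-⊕ g (sumForm gs) x)) e

    sumForm-≈0⇐ : ∀ gs → All (λ g → eval g x ≈ 0#) gs → eval (sumForm gs) x ≈ 0#
    sumForm-≈0⇐ []       []       = eval-constantForm 0# x
    sumForm-≈0⇐ (g ∷ gs) (p ∷ ps) = trans (eval-⊕ g (sumForm gs) x)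
      (trans (+-cong p (sumForm-≈0⇐ gs ps)) (+-identityˡ 0#))

  -- The sum of forms that are nonnegative on S vanishes exactly where all of them do.
  zeros-face : {S : Subset n} (gs : List (AffineForm n)) →
               (∀ {x} → x ∈ S → All (λ g → 0# ≤ eval g x) gs) →
               IsFace (S ∩ (λ x → All (λ g → eval g x ≈ 0#) gs)) S
  zeros-face {S = S} gs nonneg
    with em {P = Satisfiable (S ∩ (λ x → All (λ g → eval g x ≈ 0#) gs))}
       | em {P = Nondegenerate (⊖ sumForm gs)}
  ... | no ¬sat           | _      = inj₁ (empty-≐∅ ¬sat)
  -- A degenerate sum is constant; it is zero at `w`, so the face is all of `S`.
  ... | yes (w , w∈S , z) | no ¬nd = inj₂ (inj₁ (proj₁ , λ x∈S → x∈S ,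
    sumForm-≈0⇒ gs (nonneg x∈S) (-≈0⁻¹ (trans (sym (eval-⊖ (sumForm gs) _))
      (trans (eval-degenerate (⊖ sumForm gs) ¬nd _ w)
        (trans (eval-⊖ (sumForm gs) w) (-≈0 (sumForm-≈0⇐ gs z))))))))
  -- The sum is negated because `halfSpace` is the side where a form is at most zero.
  ... | yes (w , w∈S , z) | yes nd = inj₂ (inj₂ (⊖ sumForm gs ,
    ( nd
    , (λ x∈S → 0≤-⇒≤0 (≤-respʳ-≈
        (trans (solve 1 (λ a → a := :- (:- a)) refl _) (-‿cong (sym (eval-⊖ (sumForm gs) _))))
        (sumForm-nonneg gs (nonneg x∈S))))
    , w , w∈S , ⇐ z) ,
    Product.map₂ ⇐ ,
    λ (x∈S , e) → x∈S ,
      sumForm-≈0⇒ gs (nonneg x∈S) (-≈0⁻¹ (trans (sym (eval-⊖ (sumForm gs) _)) e))))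
    where
    ⇐ : ∀ {x} → All (λ g → eval g x ≈ 0#) gs → x ∈ zeroSet (⊖ sumForm gs)
    ⇐ z = trans (eval-⊖ (sumForm gs) _) (-≈0 (sumForm-≈0⇐ gs z))

  -- On the weak side s of h, being also on the weak side t means gap s t h = 0.
  gap : Sgn → Sgn → AffineForm n → AffineForm n
  gap pos neg h = h
  gap pos zer h = h
  gap neg zer h = ⊖ h
  gap neg pos h = ⊖ h
  gap zer _   h = constantForm 0#
  gap neg neg h = constantForm 0#
  gap pos pos h = constantForm 0#

  module _ (h : AffineForm n) {x : ℝ^ n} where
    private
      ⊖-nonneg : 0# ≤ - eval h x → 0# ≤ eval (⊖ h) x
      ⊖-nonneg = ≤-respʳ-≈ (sym (eval-⊖ h x))

      0-nonneg : 0# ≤ eval (constantForm 0#) x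
      0-nonneg = ≤-reflexive (sym (eval-constantForm 0# x))

      ⊖≈0 : eval h x ≈ 0# → eval (⊖ h) x ≈ 0#
      ⊖≈0 e = trans (eval-⊖ h x) (-≈0 e)

      ⊖≈0⁻¹ : eval (⊖ h) x ≈ 0# → eval h x ≈ 0#
      ⊖≈0⁻¹ e = -≈0⁻¹ (trans (sym (eval-⊖ h x)) e)

    gap-nonneg : ∀ s t → Weak s (eval h x) → 0# ≤ eval (gap s t h) x
    gap-nonneg pos neg p = p
    gap-nonneg pos zer p = p
    gap-nonneg neg zer p = ⊖-nonneg p
    gap-nonneg neg pos p = ⊖-nonneg p
    gap-nonneg zer _   p = 0-nonneg
    gap-nonneg neg neg p = 0-nonneg
    gap-nonneg pos pos p = 0-nonneg

    gap-≈0⇒Weak : ∀ s t → Weak s (eval h x) → eval (gap s t h) x ≈ 0# → Weak t (eval h x)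
    gap-≈0⇒Weak pos neg p e = Weak-0 neg e
    gap-≈0⇒Weak pos zer p e = e
    gap-≈0⇒Weak neg zer p e = ⊖≈0⁻¹ e
    gap-≈0⇒Weak neg pos p e = Weak-0 pos (⊖≈0⁻¹ e)
    gap-≈0⇒Weak zer t   p e = Weak-0 t p
    gap-≈0⇒Weak neg neg p e = p
    gap-≈0⇒Weak pos pos p e = p

    Weak⇒gap-≈0 : ∀ s t → Weak s (eval h x) → Weak t (eval h x) → eval (gap s t h) x ≈ 0#
    Weak⇒gap-≈0 pos neg p q = Weak-0≤-asym p q
    Weak⇒gap-≈0 pos zer p q = q
    Weak⇒gap-≈0 neg zer p q = ⊖≈0 q
    Weak⇒gap-≈0 neg pos p q = ⊖≈0 (Weak-0≤-asym q p)
    Weak⇒gap-≈0 zer _   p q = eval-constantForm 0# x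
    Weak⇒gap-≈0 neg neg p q = eval-constantForm 0# x
    Weak⇒gap-≈0 pos pos p q = eval-constantForm 0# x

  -- Ss may contain sets outside K: excluded middle discards them.
  finite-cover : (K : Cells n) → (∀ {S T} → S ≐ T → T ∈ K → S ∈ K) →
                 (Ss : List (Subset n)) → (∀ S → S ∈ K → Any (S ≐_) Ss) → Finite K
  finite-cover {n} K resp Ss covers =
    proj₁ (select Ss) , λ S → mk⇔
      (λ S∈K → proj₁ (proj₂ (select Ss)) S∈K (covers S S∈K))
      (proj₂ (proj₂ (select Ss)))
    where
    select : (Ss : List (Subset n)) → Σ[ Ts ∈ List (Subset n) ]
      (∀ {S} → S ∈ K → Any (S ≐_) Ss → Any (S ≐_) Ts) ×
      (∀ {S} → Any (S ≐_) Ts → S ∈ K)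
    select [] = [] , (λ { _ () }) , λ ()
    select (S ∷ Ss) with em {P = S ∈ K} | select Ss
    ... | yes S∈K | Ts , p , q = S ∷ Ts ,
      (λ { T∈K (here e) → here e ; T∈K (there a) → there (p T∈K a) }) ,
      λ { (here e) → resp e S∈K ; (there a) → q a }
    ... | no S∉K | Ts , p , q = Ts ,
      (λ { T∈K (here e) → contradiction (resp (≐-sym e) T∈K) S∉K
         ; T∈K (there a) → p T∈K a }) , q

  -- Sign systems and their complexes.

  -- A finite family of functions that are affine wherever their weak signs are
  -- prescribed; the prescribed region is cut out by these affine forms alone.
  record SignSystem (n : ℕ) : Set₁ where
    field
      Label    : Set
      labels  : List Label
      complete : ∀ i → i List.∈ labels
      φ        : Label → ℝ^ n → ℝ

    Piece : (Label → Sgn) → Subset n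
    Piece s x = ∀ i → Weak (s i) (φ i x)

    field
      -- The form depends on the whole sign vector: in a deeper layer the affine expression of a
      -- preactivation depends on which earlier ReLUs are active.
      form   : (Label → Sgn) → Label → AffineForm n
      φ-form : ∀ s {x} → x ∈ Piece s → ∀ i → φ i x ≈ eval (form s i) x
      -- This does not follow from `φ-form`, which presupposes membership of the region.
      cut    : ∀ s {x} → (∀ i → Weak (s i) (eval (form s i) x)) → x ∈ Piece s

    -- `∅` has its own constructor: it is a face of every cell, but need not be a `Piece`. Different
    -- sign vectors may give the same region.
    data Cell (T : Subset n) : Set₁ where
      empty : T ≐ ∅ → Cell T
      piece : ∀ s → T ≐ Piece s → Cell T

    Cell-resp : ∀ {S T} → S ≐ T → Cell T → Cell S
    Cell-resp e (empty p)   = empty (≐-trans e p)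
    Cell-resp e (piece s p) = piece s (≐-trans e p)

    signs : ℝ^ n → Label → Sgn
    signs x i = sgn (φ i x)

    ∈-Piece-signs : ∀ x → x ∈ Piece (signs x)
    ∈-Piece-signs x i = Str⇒Weak (signs x i) (Str-sgn (φ i x))

    -- By `Str-Weak-mono` at each label. So `Piece (signs x)` is the smallest piece around x.
    Piece-signs-⊆ : ∀ s {x} → x ∈ Piece s → Piece (signs x) ⊆ Piece s
    Piece-signs-⊆ s {x} x∈ y∈ i =
      Str-Weak-mono (signs x i) (s i) (Str-sgn (φ i x)) (x∈ i) (y∈ i)

    φ-line : ∀ s {x y t} → x ∈ Piece s → y ∈ Piece s → line x y t ∈ Piece s →
             ∀ i → φ i (line x y t) ≈ φ i x + t * (φ i y - φ i x)
    φ-line s {x} {y} {t} x∈ y∈ z∈ i = trans (φ-form s z∈ i)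
      (trans (eval-line (form s i) x y t)
        (+-cong (sym (φ-form s x∈ i)) (*-congˡ
          (+-cong (sym (φ-form s y∈ i)) (-‿cong (sym (φ-form s x∈ i)))))))

    -- The forms of `s` are affine along the whole line, so `cut` applies before the point is known
    -- to lie in the region. The parameter is unrestricted: a negative `t` continues the segment
    -- beyond x.
    ∈-Piece-line : ∀ s {x y t} → x ∈ Piece s → y ∈ Piece s →
                   (∀ i → Weak (s i) (φ i x + t * (φ i y - φ i x))) → line x y t ∈ Piece s
    ∈-Piece-line s {x} {y} {t} x∈ y∈ p = cut s λ i → Weak-resp (s i)
      (sym (trans (eval-line (form s i) x y t)
        (+-cong (sym (φ-form s x∈ i)) (*-congˡ
          (+-cong (sym (φ-form s y∈ i)) (-‿cong (sym (φ-form s x∈ i)))))))) (p i)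

    midpoint-∈ : ∀ s {x y} → x ∈ Piece s → y ∈ Piece s → line x y ½ ∈ Piece s
    midpoint-∈ s x∈ y∈ = ∈-Piece-line s x∈ y∈ λ i →
      Weak-convex (s i) (proj₁ 0<½) ½≤1 (x∈ i) (y∈ i)

    -- A point of T at which as few φ i as possible vanish.
    relative-interior : ∀ s {T : Subset n} → T ⊆ Piece s →
      (∀ {x y} → x ∈ T → y ∈ T → line x y ½ ∈ T) → Satisfiable T → ∀ is →
      ∃[ w ] w ∈ T × All (λ i → φ i w ≈ 0# → ∀ y → y ∈ T → φ i y ≈ 0#) is
    relative-interior s T⊆ mid (w , w∈) [] = w , w∈ , []
    relative-interior s {T} T⊆ mid sat (i ∷ is)
      with relative-interior s T⊆ mid sat is
         | em {P = ∃[ y ] y ∈ T × ¬ φ i y ≈ 0#}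
    ... | w , w∈ , ps | no ¬∃ =
      w , w∈ , (λ _ y y∈ → byContradiction λ y≉0 → ¬∃ (y , y∈ , y≉0)) ∷ ps
    -- At the midpoint of `w` and `v` a function vanishes only if it vanishes at both, so `φ i` does
    -- not, and the earlier labels keep their property.
    ... | w , w∈ , ps | yes (v , v∈ , v≉0) = line w v ½ , mid w∈ v∈ ,
      (λ e → contradiction (proj₂ (both i e)) v≉0) ∷
      All.map (λ p e → p (proj₁ (both _ e))) ps
      where
      both : ∀ j → φ j (line w v ½) ≈ 0# → φ j w ≈ 0# × φ j v ≈ 0#
      both j e = Weak-midpoint-0 (s j) (T⊆ w∈ j) (T⊆ v∈ j)
        (trans (sym (φ-line s (T⊆ w∈) (T⊆ v∈) (T⊆ (mid w∈ v∈)) j)) e)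

    -- From a relative interior point w one can move slightly away from any
    -- point y of Piece (signs w), where h is still nonpositive: so h y = 0.
    supporting-face : ∀ s h → Piece s ⊆ halfSpace h → Satisfiable (Piece s ∩ zeroSet h) →
                      ∃[ w ] Piece s ∩ zeroSet h ≐ Piece (signs w)
    supporting-face s h below sat = w , to , from
      where
      T = Piece s ∩ zeroSet h
      mid : ∀ {x y} → x ∈ T → y ∈ T → line x y ½ ∈ T
      mid {x} {y} (x∈ , x0) (y∈ , y0) = midpoint-∈ s x∈ y∈ ,
        trans (eval-line h x y ½) (trans (+-cong x0 (*-congˡ (+-cong y0 (-‿cong x0))))
          (solve 1 (λ t → con 0ℤ :+ t :* (con 0ℤ :- con 0ℤ) := con 0ℤ) refl ½))
      interior = relative-interior s proj₁ mid sat labels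
      w = proj₁ interior
      w∈ : w ∈ Piece s
      w∈ = proj₁ (proj₁ (proj₂ interior))
      hw≈0 : eval h w ≈ 0#
      hw≈0 = proj₂ (proj₁ (proj₂ interior))
      to : T ⊆ Piece (signs w)
      -- Where `φ i` vanishes at `w`, it vanishes on all of `T` by the choice of `w`; elsewhere the
      -- sign at `w` is `s i`.
      to {y} y∈T i with em {P = φ i w ≈ 0#}
      ... | yes e = Weak-0 (signs w i) (All.lookup (proj₂ (proj₂ interior)) (complete i) e y y∈T)
      ... | no  p = Weak-Str-mono (signs w i) (s i) (Str-sgn (φ i w)) p (w∈ i) (proj₁ y∈T i)
      from : Piece (signs w) ⊆ T
      from {y} y∈′ = y∈ , antisym (below y∈) hy≥0
        where
        y∈ : y ∈ Piece s
        y∈ = Piece-signs-⊆ s w∈ y∈′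
        -- The rate of change of `φ i` on moving from `w` away from `y`. It is zero where `φ i w` is
        -- zero, since `y` then has `φ i y` zero too.
        c : Label → ℝ
        c i = - (φ i y - φ i w)
        small : ∃[ δ ] 0# < δ × All (λ i → Str (signs w i) (φ i w + δ * c i)) labels
        small = Eventually-witness (Eventually-All labels λ i →
          Eventually-Str (signs w i) (c i) (Str-sgn (φ i w)) λ e →
            -≈0 (trans (+-cong
              (sgn-zer (φ i w) e (y∈′ i)) (-‿cong e)) (-‿inverseʳ 0#)))
          where
          sgn-zer : ∀ x {y} → x ≈ 0# → Weak (sgn x) y → y ≈ 0#
          sgn-zer x e p = Str-Weak-mono (sgn x) zer (Str-sgn x) e p
        δ = proj₁ small
        z = line w y (- δ)
        z∈ : z ∈ Piece s
        z∈ = ∈-Piece-line s w∈ y∈ λ i → Str-Weak-mono (signs w i) (s i) (Str-sgn (φ i w)) (w∈ i)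
          (Str⇒Weak (signs w i) (Str-resp (signs w i)
            (solve 3 (λ a b d → a :+ d :* (:- (b :- a)) := a :+ :- d :* (b :- a)) refl
              (φ i w) (φ i y) δ)
            (All.lookup (proj₂ (proj₂ small)) (complete i))))
        -- As `h` vanishes at `w`, its value at `z` is -δ times its value at `y`, and it is
        -- nonpositive at `z`.
        0≤δhy : 0# ≤ δ * eval h y
        0≤δhy = ≤-respʳ-≈ (trans (-‿cong (trans (eval-line h w y (- δ))
            (+-cong hw≈0 (*-congˡ (+-congˡ (-‿cong hw≈0))))))
            (solve 2 (λ d b → :- (con 0ℤ :+ :- d :* (b :- con 0ℤ)) := d :* b) refl δ (eval h y)))
          (≤0⇒0≤- (below z∈))
        hy≥0 : 0# ≤ eval h y
        hy≥0 = byContradiction λ ¬p → <⇒≱ (*-pos (proj₁ (proj₂ small)) (-pos (≰⇒> ¬p)))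
          (0≤-⇒≤0 (≤-respʳ-≈ (solve 2 (λ d b → d :* b := :- (d :* :- b)) refl δ (eval h y)) 0≤δhy))
          where
          -pos : ∀ {a} → a < 0# → 0# < - a
          -pos p = <-respʳ-≈ (+-identityˡ _) (<⇒0<- p)

    face-Cell : ∀ s {T} → IsFace T (Piece s) → Cell T
    face-Cell s (inj₁ p)        = empty p
    face-Cell s (inj₂ (inj₁ p)) = piece s p
    face-Cell s (inj₂ (inj₂ (h , (_ , below , sat) , p))) =
      let w , q = supporting-face s h below sat in piece (signs w) (≐-trans p q)

    -- The zero form vanishes everywhere, so the face it cuts out is the whole piece;
    -- `supporting-face` then supplies the point `w`.
    Cell-signs : ∀ {T} → Cell T → T ≐ ∅ ⊎ ∃[ w ] T ≐ Piece (signs w)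
    Cell-signs (empty p) = inj₁ p
    Cell-signs {T} (piece s p) with em {P = Satisfiable T}
    ... | no ¬sat       = inj₁ (empty-≐∅ ¬sat)
    ... | yes (v , v∈T) =
      let w , q = supporting-face s (constantForm 0#)
                    (λ {x} _ → ≤-reflexive (eval-constantForm 0# x))
                    (v , proj₁ p v∈T , eval-constantForm 0# v)
      in inj₂ (w , ≐-trans p (≐-trans whole q))
      where
      whole : Piece s ≐ Piece s ∩ zeroSet (constantForm 0#)
      whole = (λ {x} x∈ → x∈ , eval-constantForm 0# x) , proj₁

    -- On `Piece s` the `gap` forms are nonnegative, and they vanish together exactly at the points
    -- of `Piece t`, so `zeros-face` applies.
    Piece-∩-face : ∀ s t → IsFace (Piece s ∩ Piece t) (Piece s)
    Piece-∩-face s t = IsFace-resp ≐-refl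
      ( (λ (x∈ , zs) → x∈ , λ i → Weak-resp (t i) (sym (φ-form s x∈ i))
          (gap-≈0⇒Weak (form s i) (s i) (t i) (weak x∈ i) (All.lookup (All.map⁻ zs) (complete i))))
      , (λ (x∈ , x∈′) → x∈ , All.map⁺ (All.tabulate λ {i} _ →
          Weak⇒gap-≈0 (form s i) (s i) (t i) (weak x∈ i)
            (Weak-resp (t i) (φ-form s x∈ i) (x∈′ i)))))
      (zeros-face (List.map (λ i → gap (s i) (t i) (form s i)) labels)
        λ x∈ → All.map⁺ (All.tabulate λ {i} _ → gap-nonneg (form s i) (s i) (t i) (weak x∈ i)))
      where
      weak : ∀ {x} → x ∈ Piece s → ∀ i → Weak (s i) (eval (form s i) x)
      weak x∈ i = Weak-resp (s i) (φ-form s x∈ i) (x∈ i)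

    Cell-∩-face : ∀ {S T} → Cell S → Cell T → IsFace (S ∩ T) S
    Cell-∩-face (empty p) _ = inj₁ ((λ (x∈ , _) → proj₁ p x∈) , λ ())
    Cell-∩-face _ (empty p) = inj₁ ((λ (_ , x∈) → proj₁ p x∈) , λ ())
    Cell-∩-face (piece s p) (piece t q) = IsFace-resp (≐-sym p)
      ( (λ (x∈ , y∈) → proj₂ p x∈ , proj₂ q y∈)
      , (λ (x∈ , y∈) → proj₁ p x∈ , proj₁ q y∈)) (Piece-∩-face s t)

    Piece-polyhedral : 0 ℕ.< n → ∀ s → IsPolyhedral (Piece s)
    Piece-polyhedral 0<n s = polyhedral-resp
      ( (λ x∈ → All.concat⁺ {xss = List.map constraints labels} (All.map⁺ (All.tabulate λ {i} _ →
          Weak⇒signConstraints (s i) (form s i) (Weak-resp (s i) (φ-form s x∈ i) (x∈ i)))))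
      , (λ ps → cut s λ i → signConstraints⇒Weak (s i) (form s i)
          (All.lookup (All.map⁻ (All.concat⁻ {xss = List.map constraints labels} ps)) (complete i))))
      (polyhedral-All 0<n (concatMap constraints labels))
      where
      constraints : Label → List (AffineForm n)
      constraints i = signConstraints (s i) (form s i)

    -- Candidates are built label by label, each label intersecting the earlier regions with one of
    -- three weak conditions. This avoids enumerating functions from labels to signs.
    Cell-finite : Finite Cell
    Cell-finite = finite-cover Cell Cell-resp (∅ ∷ regions labels) λ where
        S (empty p)   → here p
        S (piece s p) → there (Any.map (λ q → ≐-trans p (≐-trans (all s) q)) (covered s labels))
      where
      slices : List (Subset n) → Label → Sgn → List (Subset n)
      slices Ss i t = List.map (λ S → (λ x → Weak t (φ i x)) ∩ S) Ss
      regions : List Label → List (Subset n)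
      regions []       = U ∷ []
      regions (i ∷ is) = concatMap (slices (regions is) i) (neg ∷ zer ∷ pos ∷ [])
      ∈-signs : ∀ t → t List.∈ (neg ∷ zer ∷ pos ∷ [])
      ∈-signs neg = here ≡.refl
      ∈-signs zer = there (here ≡.refl)
      ∈-signs pos = there (there (here ≡.refl))
      covered : ∀ s is →
                Any ((λ x → All (λ i → Weak (s i) (φ i x)) is) ≐_) (regions is)
      covered s []       = here ((λ _ → tt) , λ _ → [])
      covered s (i ∷ is) = Any.concatMap⁺ (slices (regions is) i) (Any.map
        (λ { ≡.refl → Any.map⁺ (Any.map (λ (p , q) →
          (λ { (a ∷ as) → a , p as }) , λ (a , b) → a ∷ q b) (covered s is)) })
        (∈-signs (s i)))
      all : ∀ s → Piece s ≐ (λ x → All (λ i → Weak (s i) (φ i x)) labels)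
      all s = (λ x∈ → All.tabulate λ {i} _ → x∈ i) , λ ps i → All.lookup ps (complete i)

    Cell-decomposition : 0 ℕ.< n → IsPolyhedralDecomposition Cell
    Cell-decomposition 0<n = record
      { finite     = Cell-finite
      ; polyhedral = λ where
          S (empty p)   → polyhedral-resp p (polyhedral-∅ 0<n)
          S (piece s p) → polyhedral-resp p (Piece-polyhedral 0<n s)
      ; faceClosed = λ where
          S T (empty p)   f → empty ((λ x∈ → proj₁ p (IsFace-⊆ f x∈)) , λ ())
          S T (piece s p) f → face-Cell s (IsFace-resp p ≐-refl f)
      ; commonFace = λ S T S∈ T∈ → Cell-∩-face S∈ T∈ ,
          IsFace-resp ≐-refl (Product.swap , Product.swap) (Cell-∩-face T∈ S∈)
      } , (λ _ → tt) , λ {x} _ →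
        Piece (signs x) , piece (signs x) ≐-refl , ∈-Piece-signs x

    -- Requiring `φ i` to vanish on the whole cell makes the condition pass to faces. For networks
    -- `J` consists of the nondegenerate rows of all layers so far.
    VanishingCell : Pred Label 0ℓ → Cells n
    VanishingCell J T =
      Cell T × (T ≐ ∅ ⊎ ∃[ i ] i ∈ J × (∀ {x} → x ∈ T → φ i x ≈ 0#))

    VanishingCell-faceClosed : ∀ J → FaceClosed Cell → FaceClosed (VanishingCell J)
    VanishingCell-faceClosed J closed S T (S∈ , inj₁ p) f =
      closed S T S∈ f , inj₁ ((λ x∈ → proj₁ p (IsFace-⊆ f x∈)) , λ ())
    VanishingCell-faceClosed J closed S T (S∈ , inj₂ (i , i∈J , z)) f =
      closed S T S∈ f , inj₂ (i , i∈J , λ x∈ → z (IsFace-⊆ f x∈))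

    -- If `φ i x` is zero, the sign of x at `i` is `zer`, so `φ i` vanishes on all of
    -- `Piece (signs x)`, a cell containing x.
    VanishingCell-domain : ∀ J → domain (VanishingCell J) ≐ λ x → ∃[ i ] i ∈ J × φ i x ≈ 0#
    VanishingCell-domain J =
      (λ { (T , (_ , inj₁ p) , x∈) → ⊥-elim (proj₁ p x∈)
         ; (T , (_ , inj₂ (i , i∈J , z)) , x∈) → i , i∈J , z x∈ }) ,
      λ { {x} (i , i∈J , e) → Piece (signs x) ,
        (piece (signs x) ≐-refl , inj₂ (i , i∈J , λ y∈ →
          Str-Weak-mono (signs x i) zer (Str-sgn (φ i x)) e (y∈ i))) , ∈-Piece-signs x }

  complex-resp : {K K′ : Cells n} → K ≐ K′ → IsPolyhedralComplex K → IsPolyhedralComplex K′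
  complex-resp (to , from) K-complex = record
    { finite     = proj₁ finite , λ S → mk⇔
        (λ S∈ → Equivalence.to (proj₂ finite S) (from S∈))
        (λ a → to (Equivalence.from (proj₂ finite S) a))
    ; polyhedral = λ S S∈ → polyhedral S (from S∈)
    ; faceClosed = λ S T S∈ f → to (faceClosed S T (from S∈) f)
    ; commonFace = λ S T S∈ T∈ → commonFace S T (from S∈) (from T∈)
    }
    where open IsPolyhedralComplex K-complex

  decomposition-resp : {K K′ : Cells n} → K ≐ K′ →
                       IsPolyhedralDecomposition K → IsPolyhedralDecomposition K′
  decomposition-resp e (c , _ , covers) = complex-resp e c , (λ _ → tt) ,
    λ x∈U → let S , S∈ , x∈ = covers x∈U in S , proj₁ e S∈ , x∈

-- Continuity, closures and connectedness.

module Arrangements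
  (em : ∀ {ℓ} → ExcludedMiddle ℓ) (𝓡 : CompleteOrderedField) where

  open SignSystems em 𝓡 public

  private
    variable
      n k p : ℕ

  Near-≈ : ∀ {ε} {x y : ℝ^ n} → 0# < ε → (∀ i → x i ≈ y i) → Near ε x y
  Near-≈ 0<ε p i =
    <-respˡ-≈ (sym (trans (+-congʳ (p i)) (-‿inverseʳ _))) 0<ε ,
    <-respˡ-≈ (sym (trans (+-congʳ (sym (p i))) (-‿inverseʳ _))) 0<ε

  Near-respʳ : ∀ {ε} {x y z : ℝ^ n} → (∀ i → y i ≈ z i) → Near ε x y → Near ε x z
  Near-respʳ p q i = <-respˡ-≈ (+-congˡ (-‿cong (p i))) (proj₁ (q i)) ,
                     <-respˡ-≈ (+-congʳ (p i)) (proj₂ (q i))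

  Near-sym : ∀ {ε} {x y : ℝ^ n} → Near ε x y → Near ε y x
  Near-sym p i = Product.swap (p i)

  -- A general `Subset` need not respect coordinatewise `_≈_`; an open one does, as such points are
  -- `Near` for every positive radius.
  Open-resp : {P : Subset n} → Open P → ∀ {x y} → (∀ i → x i ≈ y i) → x ∈ P → y ∈ P
  Open-resp open-P e x∈P = let ε , 0<ε , near⇒∈ = open-P _ x∈P in near⇒∈ _ (Near-≈ 0<ε e)

  closure-resp : {S T : Subset n} → S ≐ T → closure S ≐ closure T
  closure-resp (p , q) =
    (λ x∈ ε 0<ε → Product.map₂ (Product.map₂ p) (x∈ ε 0<ε)) ,
    (λ x∈ ε 0<ε → Product.map₂ (Product.map₂ q) (x∈ ε 0<ε))

  -- Here c plays the role of |w|.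
  *-bound : ∀ w → ∃[ c ] 0# ≤ c × (∀ {d r} → d ≤ r → - d ≤ r → w * d ≤ c * r)
  *-bound w with total 0# w
  ... | inj₁ 0≤w = w , 0≤w , λ {d} {r} d≤r _ → 0≤-⇒≤ (≤-respʳ-≈
    (solve 3 (λ w d r → w :* (r :- d) := w :* r :- w :* d) refl w d r) (*-nonneg 0≤w (≤⇒0≤- d≤r)))
  ... | inj₂ w≤0 = - w , ≤0⇒0≤- w≤0 , λ {d} {r} _ -d≤r → 0≤-⇒≤ (≤-respʳ-≈
    (solve 3 (λ w d r → :- w :* (r :- :- d) := :- w :* r :- w :* d) refl w d r)
    (*-nonneg (≤0⇒0≤- w≤0) (≤⇒0≤- -d≤r)))

  -- The constant is 1 plus the sum of the absolute values of the coordinates of `v`; the 1 makes it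
  -- positive and the inequality strict.
  ·-lipschitz : (v : ℝ^ n) → ∃[ M ] 0# < M ×
                (∀ {x y r} → 0# < r → Near r x y → v · x - v · y < M * r)
  ·-lipschitz {zero} v = 1# , 0<1 , λ {_} {_} {r} 0<r _ → 0<-⇒< (<-respʳ-≈
    (solve 1 (λ r → r := con 1ℤ :* r :- (con 0ℤ :- con 0ℤ)) refl r) 0<r)
  ·-lipschitz {suc n} v with *-bound (v zero) | ·-lipschitz (v ∘ suc)
  ... | c , 0≤c , bound | M , 0<M , lip = c + M , +-nonneg-pos 0≤c 0<M , λ {x} {y} {r} 0<r near →
    0<-⇒< (<-respʳ-≈
      (solve 8 (λ c M r v x y a b →
        (c :* r :- v :* (x :- y)) :+ (M :* r :- (a :- b))
          := (c :+ M) :* r :- ((v :* x :+ a) :- (v :* y :+ b))) refl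
        c M r (v zero) (x zero) (y zero) ((v ∘ suc) · (x ∘ suc)) ((v ∘ suc) · (y ∘ suc)))
      (+-nonneg-pos
        (≤⇒0≤- (bound (proj₁ (proj₁ (near zero))) (≤-respˡ-≈
          (solve 2 (λ x y → y :- x := :- (x :- y)) refl (x zero) (y zero))
          (proj₁ (proj₂ (near zero))))))
        (<⇒0<- (lip 0<r (near ∘ suc)))))

  eval-continuous : (h : AffineForm n) (x : ℝ^ n) {ε : ℝ} → 0# < ε →
    Eventually (λ δ → ∀ y → Near δ x y →
      (eval h x - eval h y < ε) × (eval h y - eval h x < ε))
  eval-continuous h x {ε} 0<ε with ·-lipschitz (normal h)
  ... | M , 0<M , lip with inverse-pos 0<M
  ...   | N , 0<N , MN≈1 = Eventually-map
    (λ {δ} 0<δ δ≤ y near → close δ≤ (lip 0<δ near) , close δ≤ (lip 0<δ (Near-sym near)))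
    -- `N` is 1 / M, so the radius is at most ε / M.
    (Eventually-≤ (*-pos 0<ε 0<N))
    where
    close : ∀ {δ x y} → δ ≤ ε * N → normal h · x - normal h · y < M * δ →
            eval h x - eval h y < ε
    close {δ} {x} {y} δ≤ p = <-≤-trans (<-respˡ-≈
      (solve 3 (λ a b c → a :- b := (a :+ c) :- (b :+ c)) refl
        (normal h · x) (normal h · y) (offset h)) p)
      (0≤-⇒≤ (≤-respʳ-≈ (trans
        (solve 4 (λ M e N d → M :* (e :* N :- d) := e :* (M :* N) :- M :* d) refl M ε N δ)
        (+-congʳ (trans (*-congˡ MN≈1) (trans (*-comm ε 1#) (*-identityˡ ε)))))
        (*-nonneg (proj₁ 0<M) (≤⇒0≤- δ≤))))

  apply-continuous : (A : AffineMap n k) → Continuous (apply A)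
  apply-continuous A x ε 0<ε =
    let δ , 0<δ , p = Eventually-witness (Eventually-Fin λ j → eval-continuous (row A j) x 0<ε)
    in δ , 0<δ , λ y near j → p j y near

  ∘-continuous : {f : ℝ^ n → ℝ^ k} {g : ℝ^ k → ℝ^ p} →
                 Continuous f → Continuous g → Continuous (g ∘ f)
  ∘-continuous {f = f} f-cont g-cont x ε 0<ε =
    let δ , 0<δ , p = g-cont (f x) ε 0<ε
        δ′ , 0<δ′ , q = f-cont x δ 0<δ
    in δ′ , 0<δ′ , λ y near → p (f y) (q y near)

  relu-cases : ∀ a → (0# ≤ a × 0# ⊔ a ≈ a) ⊎ (0# ≤ - a × 0# ⊔ a ≈ 0#)
  relu-cases a with total 0# a
  ... | inj₁ p = inj₁ (p , MaxOperator.x≤y⇒x⊔y≈y (NaturalMax.maxOperator totalOrder) p)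
  ... | inj₂ p = inj₂ (≤0⇒0≤- p , MaxOperator.x≥y⇒x⊔y≈x (NaturalMax.maxOperator totalOrder) p)

  -- For b ≤ 0 ≤ a the difference is a, at most a - b; for a ≤ 0 ≤ b it is -b, at most 0.
  relu-nonexpansive : ∀ {a b ε} → 0# < ε → a - b < ε → (0# ⊔ a) - (0# ⊔ b) < ε
  relu-nonexpansive {a} {b} {ε} 0<ε a-b<ε with relu-cases a | relu-cases b
  ... | inj₁ (_ , ea) | inj₁ (_ , eb) = <-respˡ-≈ (sym (+-cong ea (-‿cong eb))) a-b<ε
  ... | inj₁ (_ , ea) | inj₂ (b≤0 , eb) = <-respˡ-≈ (sym (+-cong ea (-‿cong eb))) (0<-⇒<
    (<-respʳ-≈ (solve 3 (λ a b e → :- b :+ (e :- (a :- b)) := e :- (a :- con 0ℤ)) refl a b ε)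
      (+-nonneg-pos b≤0 (<⇒0<- a-b<ε))))
  ... | inj₂ (_ , ea) | inj₁ (0≤b , eb) = <-respˡ-≈ (sym (+-cong ea (-‿cong eb))) (0<-⇒<
    (<-respʳ-≈ (solve 2 (λ b e → b :+ e := e :- (con 0ℤ :- b)) refl b ε) (+-nonneg-pos 0≤b 0<ε)))
  ... | inj₂ (_ , ea) | inj₂ (_ , eb) = <-respˡ-≈ (sym (trans (+-cong ea (-‿cong eb))
    (-‿inverseʳ 0#))) 0<ε

  σ-continuous : Continuous (σ {n})
  σ-continuous x ε 0<ε = ε , 0<ε , λ y near i →
    relu-nonexpansive 0<ε (proj₁ (near i)) , relu-nonexpansive 0<ε (proj₂ (near i))

  positive-open : (h : AffineForm n) → Open (λ x → 0# < eval h x)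
  positive-open h x 0<hx =
    let δ , 0<δ , p = Eventually-witness (eval-continuous h x 0<hx)
    in δ , 0<δ , λ y near → <-respʳ-≈
      (solve 2 (λ a b → a :- (a :- b) := b) refl (eval h x) (eval h y))
      (<⇒0<- (proj₁ (p y near)))

  -- If h were negative at x, it would be negative on a neighbourhood of x, and that neighbourhood
  -- meets S.
  nonneg-closed : (h : AffineForm n) {S : Subset n} → (∀ {y} → y ∈ S → 0# ≤ eval h y) →
                  ∀ {x} → x ∈ closure S → 0# ≤ eval h x
  nonneg-closed h nonneg {x} x∈ = byContradiction λ ¬p →
    let ⊖h>0 = <-respʳ-≈ (trans (+-identityˡ _) (sym (eval-⊖ h x))) (<⇒0<- (≰⇒> ¬p))
        δ , 0<δ , p = positive-open (⊖ h) x ⊖h>0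
        y , near , y∈S = x∈ δ 0<δ
    in <⇒≱ (p y near) (≤-respˡ-≈ (sym (eval-⊖ h y)) (0≤-⇒≤0
         (≤-respʳ-≈ (solve 1 (λ a → a := :- (:- a)) refl (eval h y)) (nonneg y∈S))))

  Weak-closed : (h : AffineForm n) {S : Subset n} → ∀ s → (∀ {y} → y ∈ S → Weak s (eval h y)) →
                ∀ {x} → x ∈ closure S → Weak s (eval h x)
  Weak-closed h neg weak x∈ = ≤-respʳ-≈ (eval-⊖ h _)
    (nonneg-closed (⊖ h) (λ y∈ → ≤-respʳ-≈ (sym (eval-⊖ h _)) (weak y∈)) x∈)
  Weak-closed h zer weak x∈ = Weak-0≤-asym
    (Weak-closed h pos (λ y∈ → Weak-0 pos (weak y∈)) x∈)
    (Weak-closed h neg (λ y∈ → Weak-0 neg (weak y∈)) x∈)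
  Weak-closed h pos weak x∈ = nonneg-closed h weak x∈

  -- Continuity in the parameter; `c` is the direction of motion, `1#` for later and `- 1#` for
  -- earlier parameters.
  line-near : (x y : ℝ^ n) (t c : ℝ) {ε : ℝ} → 0# < ε →
              Eventually (λ δ → Near ε (line x y t) (line x y (t + δ * c)))
  line-near x y t c {ε} 0<ε = Eventually-Fin λ i → Eventually-map
    (λ {δ} _ (p , q) →
      0<-⇒< (<-respʳ-≈ (solve 6 (λ x y t c δ ε →
        ε :+ δ :* (c :* (y :- x))
          := ε :- ((x :+ t :* (y :- x)) :- (x :+ (t :+ δ :* c) :* (y :- x)))) refl
        (x i) (y i) t c δ ε) p) ,
      0<-⇒< (<-respʳ-≈ (solve 6 (λ x y t c δ ε →
        ε :+ δ :* (:- (c :* (y :- x)))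
          := ε :- ((x :+ (t :+ δ :* c) :* (y :- x)) :- (x :+ t :* (y :- x)))) refl
        (x i) (y i) t c δ ε) q))
    (Eventually-× (Eventually-pos 0<ε (c * (y i - x i)))
                  (Eventually-pos 0<ε (- (c * (y i - x i)))))

  line-0 : (x y : ℝ^ n) → ∀ i → line x y 0# i ≈ x i
  line-0 x y i = solve 2 (λ x y → x :+ con 0ℤ :* (y :- x) := x) refl (x i) (y i)

  line-1 : (x y : ℝ^ n) → ∀ i → line x y 1# i ≈ y i
  line-1 x y i = solve 2 (λ x y → x :+ con 1ℤ :* (y :- x) := y) refl (x i) (y i)

  line-cong : (x y : ℝ^ n) {t u : ℝ} → t ≈ u → ∀ i → line x y t i ≈ line x y u i
  line-cong x y e i = +-congˡ (*-congʳ e)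

  Open-line : {P : Subset n} → Open P → (x y : ℝ^ n) (t c : ℝ) → line x y t ∈ P →
              Eventually (λ δ → line x y (t + δ * c) ∈ P)
  Open-line open-P x y t c t∈P =
    let ε , 0<ε , near⇒∈ = open-P (line x y t) t∈P
    in Eventually-map (λ {δ} _ → near⇒∈ (line x y (t + δ * c))) (line-near x y t c 0<ε)

  -- Both open sets meet near the last parameter at which the segment lies in P.
  convex⇒connected : (C : Subset n) →
    (∀ {x y t} → x ∈ C → y ∈ C → 0# ≤ t → t ≤ 1# → line x y t ∈ C) → Connected C
  convex⇒connected {n} C convex P Q open-P open-Q C⊆P∪Q (p , p∈C , p∈P) (q , q∈C , q∈Q) =
    let s , upper , least = supremum S (0# , S0) (1# , λ _ (_ , t≤1 , _) → t≤1)
        0≤s = upper 0# S0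
        s≤1 = least 1# λ _ (_ , t≤1 , _) → t≤1
    in [ supremum∈P s upper 0≤s s≤1 , supremum∈Q s upper least ]′
         (C⊆P∪Q (convex p∈C q∈C 0≤s s≤1))
    where
    γ : ℝ → ℝ^ n
    γ = line p q
    S : Pred ℝ 0ℓ
    S t = 0# ≤ t × t ≤ 1# × γ t ∈ P
    S0 : S 0#
    S0 = ≤-refl , proj₁ 0<1 , Open-resp open-P (λ i → sym (line-0 p q i)) p∈P
    supremum∈P : ∀ s → (∀ t → S t → t ≤ s) → 0# ≤ s → s ≤ 1# → γ s ∈ P →
                 Satisfiable (C ∩ (P ∩ Q))
    -- If the last point lies in `P`, openness would carry the segment further inside `P` unless `s`
    -- is 1; then the endpoint `q` itself lies in both sets.
    supremum∈P s upper 0≤s s≤1 γs∈P = q , q∈C ,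
      Open-resp open-P (λ i → trans (line-cong p q s≈1 i) (line-1 p q i)) γs∈P , q∈Q
      where
      beyond : ∀ {δ} → 0# < δ → δ ≤ 1# - s → ¬ γ (s + δ * 1#) ∈ P
      beyond {δ} 0<δ δ≤ ∈P = contradiction
        (upper (s + δ * 1#) (≤-trans 0≤s (proj₁ s<s+δ) , s+δ≤1 , ∈P)) (<⇒≱ s<s+δ)
        where
        s<s+δ : s < s + δ * 1#
        s<s+δ = 0<-⇒< (<-respʳ-≈ (solve 2 (λ d s → d := (s :+ d :* con 1ℤ) :- s) refl δ s) 0<δ)
        s+δ≤1 : s + δ * 1# ≤ 1#
        s+δ≤1 = 0≤-⇒≤ (≤-respʳ-≈
          (solve 2 (λ d s → (con 1ℤ :- s) :- d := con 1ℤ :- (s :+ d :* con 1ℤ)) refl δ s)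
          (≤⇒0≤- δ≤))
      s≈1 : s ≈ 1#
      s≈1 = byContradiction λ s≉1 →
        let δ , 0<δ , ∈P , δ≤ = Eventually-witness (Eventually-×
              (Open-line open-P p q s 1# γs∈P) (Eventually-≤ (<⇒0<- (s≤1 , s≉1))))
        in beyond 0<δ δ≤ ∈P
    supremum∈Q : ∀ s → (∀ t → S t → t ≤ s) → (∀ u → (∀ t → S t → t ≤ u) → s ≤ u) → γ s ∈ Q →
                 Satisfiable (C ∩ (P ∩ Q))
    -- If the last point lies in `Q`, so do the points just before it, and some of these lie in `P`
    -- because `s` is a least upper bound.
    supremum∈Q s upper least γs∈Q =
      let ε , 0<ε , before = Open-line open-Q p q s (- 1#) γs∈Q
          t , t∈S , s-ε<t = close 0<ε
          0≤t , t≤1 , γt∈P = t∈S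
      in γ t , convex p∈C q∈C 0≤t t≤1 , γt∈P , γt∈Q before (upper t t∈S) s-ε<t
      where
      close : ∀ {ε} → 0# < ε → ∃[ t ] S t × s - ε < t
      close {ε} 0<ε = byContradiction λ ¬∃ → contradiction
        (least (s - ε) λ t t∈S → byContradiction λ ¬p → ¬∃ (t , t∈S , ≰⇒> ¬p))
        (<⇒≱ (0<-⇒< (<-respʳ-≈ (solve 2 (λ s e → e := s :- (s :- e)) refl s ε) 0<ε)))
      γt∈Q : ∀ {ε t} → (∀ δ → 0# < δ → δ ≤ ε → γ (s + δ * - 1#) ∈ Q) →
             t ≤ s → s - ε < t → γ t ∈ Q
      γt∈Q {ε} {t} before t≤s s-ε<t = byCases em
        where
        byCases : Dec (t ≈ s) → γ t ∈ Q
        -- `before` covers only parameters strictly smaller than `s`.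
        byCases (yes t≈s) = Open-resp open-Q (line-cong p q (sym t≈s)) γs∈Q
        byCases (no  t≉s) = Open-resp open-Q
          (line-cong p q (solve 2 (λ s t → s :+ (s :- t) :* (:- con 1ℤ) := t) refl s t))
          (before (s - t) (<⇒0<- (t≤s , t≉s))
            (0≤-⇒≤ (≤-respʳ-≈ (solve 3 (λ s t e → t :- (s :- e) := e :- (s :- t)) refl s t ε)
              (proj₁ (<⇒0<- s-ε<t)))))

  -- Chambers of a single layer.

  layerSystem : AffineMap n k → SignSystem n
  layerSystem {k = k} A = record
    { Label    = Fin k
    ; labels   = allFin k
    ; complete = ∈-allFin
    ; φ        = λ l → eval (row A l)
    ; form     = λ _ → row A
    ; φ-form   = λ _ _ _ → refl
    ; cut      = λ _ x∈ → x∈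
    }

  module _ (A : AffineMap n k) where
    open SignSystem (layerSystem A)

    private
      X : Subset n
      X = ∁ (support (layerArrangement A))

    -- Degenerate rows take part as well: they are constant, so their condition holds everywhere.
    chamber : ℝ^ n → Subset n
    chamber x y = ∀ l → Str (signs x l) (φ l y)

    chamber-convex : ∀ x {y z t} → y ∈ chamber x → z ∈ chamber x → 0# ≤ t → t ≤ 1# →
                     line y z t ∈ chamber x
    chamber-convex x {y} {z} {t} y∈ z∈ 0≤t t≤1 l = Str-resp (signs x l)
      (sym (eval-line (row A l) y z t)) (Str-convex (signs x l) 0≤t t≤1 (y∈ l) (z∈ l))

    chamber-⊆ : ∀ {x} → x ∈ X → chamber x ⊆ X
    chamber-⊆ {x} x∈X y∈ ((l , nd) , e) =
      x∈X ((l , nd) , Str-0 (signs x l) (Str-sgn (φ l x)) (y∈ l) e)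

    -- Off the hyperplanes a nondegenerate row is never zero, so its positive and negative sides are
    -- disjoint open sets covering `E`, and a connected `E` meets only one of them.
    connected-⊆-chamber : (E : Subset n) → E ⊆ X → Connected E →
                          ∀ {x} → x ∈ E → E ⊆ chamber x
    connected-⊆-chamber E E⊆X connected {x} x∈E {y} y∈E l with em {P = Nondegenerate (row A l)}
    ... | no ¬nd = Str-resp (signs x l) (eval-degenerate (row A l) ¬nd x y) (Str-sgn (φ l x))
    ... | yes nd = go (signs x l) (signs y l) (Str-sgn (φ l x)) (Str-sgn (φ l y))
      where
      h = row A l
      positive negative : Subset n
      positive z = 0# < eval h z
      negative z = 0# < eval (⊖ h) z
      cover : E ⊆ positive ∪ negative
      cover {z} z∈E with decideSgn (φ l z)
      ... | neg , p = inj₂ (<-respʳ-≈ (sym (eval-⊖ h z)) p)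
      ... | zer , e = contradiction ((l , nd) , e) (E⊆X z∈E)
      ... | pos , p = inj₁ p
      disjoint : ¬ (Satisfiable (E ∩ positive) × Satisfiable (E ∩ negative))
      disjoint (p , q) =
        let z , _ , 0<h , 0<⊖h = connected positive negative (positive-open h)
                                   (positive-open (⊖ h)) cover p q
        in proj₂ 0<h (sym (Weak-0≤-asym (proj₁ 0<h) (≤-respʳ-≈ (eval-⊖ h z) (proj₁ 0<⊖h))))
      ⊖-pos : ∀ {z} → 0# < - eval h z → 0# < eval (⊖ h) z
      ⊖-pos = <-respʳ-≈ (sym (eval-⊖ h _))
      go : ∀ s t → Str s (φ l x) → Str t (φ l y) → Str s (φ l y)
      go neg neg p q = q
      go pos pos p q = q
      go neg pos p q = contradiction ((y , y∈E , q) , (x , x∈E , ⊖-pos p)) disjoint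
      go pos neg p q = contradiction ((x , x∈E , p) , (y , y∈E , ⊖-pos q)) disjoint
      go zer t   p q = contradiction ((l , nd) , p) (E⊆X x∈E)
      go neg zer p q = contradiction ((l , nd) , q) (E⊆X y∈E)
      go pos zer p q = contradiction ((l , nd) , q) (E⊆X y∈E)

    chamber-component : ∀ {x} → x ∈ X → IsConnectedComponent X (chamber x)
    chamber-component {x} x∈X = record
      { contained = chamber-⊆ x∈X
      ; nonempty  = x , λ l → Str-sgn (φ l x)
      ; connected = convex⇒connected (chamber x) (chamber-convex x)
      ; maximal   = λ E E⊆X E-connected ⊆E →
          connected-⊆-chamber E E⊆X E-connected (⊆E λ l → Str-sgn (φ l x))
      }

    -- Any point of C determines the chamber; connectedness of C gives one inclusion, maximality the
    -- other.
    component-chamber : ∀ {C} → IsConnectedComponent X C → ∃[ x ] C ≐ chamber x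
    component-chamber {C} C-component = x , C⊆ ,
      maximal (chamber x) (chamber-⊆ (contained x∈C))
        (convex⇒connected (chamber x) (chamber-convex x)) C⊆
      where
      open IsConnectedComponent C-component
      x = proj₁ nonempty
      x∈C = proj₂ nonempty
      C⊆ : C ⊆ chamber x
      C⊆ = connected-⊆-chamber C contained connected x∈C

    -- Weak sign conditions are closed. Conversely, a point y of the piece is approached by points
    -- of the segment from y to x, which lie in the chamber.
    closure-chamber : ∀ x → closure (chamber x) ≐ Piece (signs x)
    closure-chamber x =
      (λ y∈ l → Weak-closed (row A l) (signs x l) (λ z∈ → Str⇒Weak (signs x l) (z∈ l)) y∈) ,
      λ {y} y∈ ε 0<ε →
        let δ , 0<δ , near , δ≤1 = Eventually-witness
              (Eventually-× (line-near y x 0# 1# 0<ε) (Eventually-≤ 0<1))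
        in line y x δ
         , Near-sym (Near-respʳ (line-0 y x) (Near-sym (Near-respʳ
             (line-cong y x (solve 1 (λ d → con 0ℤ :+ d :* con 1ℤ := d) refl δ)) near)))
         , λ l → Str-resp (signs x l) (sym (eval-line (row A l) y x δ))
             (Weak-Str-convex (signs x l) 0<δ δ≤1 (y∈ l) (Str-sgn (φ l x)))

    perturb : ∀ x y → ∃[ δ ] 0# < δ ×
              (∀ l → ¬ φ l x ≈ 0# → Str (signs x l) (φ l (line x y δ)))
    perturb x y = Eventually-witness (Eventually-Fin λ l → eventually l)
      where
      eventually : ∀ l → Eventually (λ δ → ¬ φ l x ≈ 0# → Str (signs x l) (φ l (line x y δ)))
      eventually l with em {P = φ l x ≈ 0#}
      ... | yes e = 1# , 0<1 , λ _ _ _ p → contradiction e p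
      ... | no  p = Eventually-map
        (λ {δ} _ q _ → Str-resp (signs x l) (sym (eval-line (row A l) x y δ)) q)
        (Eventually-Str (signs x l) (φ l y - φ l x) (Str-sgn (φ l x)) (λ e → contradiction e p))

    -- Rows are treated one at a time: if the current row vanishes at the point, a small move
    -- towards a point where it does not vanish repairs this and keeps all nonzero signs, including
    -- those of `w`.
    nearby-generic : ∀ w ls → ∃[ x ]
      All (λ l → Nondegenerate (row A l) → ¬ φ l x ≈ 0#) ls ×
      (∀ l → ¬ φ l w ≈ 0# → Str (signs w l) (φ l x))
    nearby-generic w [] = w , [] , λ l _ → Str-sgn (φ l w)
    nearby-generic w (l ∷ ls)
      with nearby-generic w ls | em {P = Nondegenerate (row A l)}
    ... | x , ps , same | no ¬nd = x , (λ nd → contradiction nd ¬nd) ∷ ps , same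
    ... | x , ps , same | yes nd with em {P = φ l x ≈ 0#} | nonzero-point (row A l) nd
    ...   | no  p | _        = x , (λ _ → p) ∷ ps , same
    ...   | yes e | y , y≉0 with perturb x y
    ...     | δ , 0<δ , keep = line x y δ ,
      -- As row `l` vanishes at `x`, its value at the new point is `δ` times its nonzero value at
      -- `y`.
      (λ _ e′ → y≉0 (integral (proj₂ 0<δ ∘ sym) (trans (sym (trans (eval-line (row A l) x y δ)
        (trans (+-cong e (*-congˡ (+-congˡ (-‿cong e))))
          (solve 2 (λ d a → con 0ℤ :+ d :* (a :- con 0ℤ) := d :* a) refl δ (φ l y))))) e′)))
      ∷ All.map (λ {j} p nd e′ → p nd
          (Str-0 (signs x j) (Str-sgn (φ j x)) (keep j (p nd)) e′)) ps ,
      λ j wj≉0 → ≡.subst (λ s → Str s (φ j (line x y δ)))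
        (Str-unique (signs x j) (signs w j) (Str-sgn (φ j x)) (same j wj≉0))
        (keep j λ e′ → wj≉0 (Str-0 (signs w j) (Str-sgn (φ j w)) (same j wj≉0) e′))

    -- A row vanishing at `w` imposes nothing on `w`, and every other row has the same sign at x as
    -- at `w`; so `w` lies in the closed chamber of x.
    generic : ∀ w → ∃[ x ] x ∈ X × w ∈ Piece (signs x)
    generic w = let x , ps , same = nearby-generic w labels in
      x , (λ ((l , nd) , e) → All.lookup ps (complete l) nd e) , λ l → weak x same l
      where
      weak : ∀ x → (∀ l → ¬ φ l w ≈ 0# → Str (signs w l) (φ l x)) → w ∈ Piece (signs x)
      weak x same l with em {P = φ l w ≈ 0#}
      ... | yes e = Weak-0 (signs x l) e
      ... | no  p = Str⇒Weak (signs x l) (≡.subst (λ s → Str s (φ l w))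
        (Str-unique (signs w l) (signs x l) (same l p) (Str-sgn (φ l x))) (Str-sgn (φ l w)))

    -- The piece of `w` is contained in every piece through `w`, so it equals its intersection with
    -- the piece of x, and intersections of pieces are faces.
    signs-face : ∀ {w x} → w ∈ Piece (signs x) → IsFace (Piece (signs w)) (Piece (signs x))
    signs-face {w} {x} w∈ =
      IsFace-resp ≐-refl ∩≐ (Piece-∩-face (signs x) (signs w))
      where
      ∩≐ : Piece (signs x) ∩ Piece (signs w) ≐ Piece (signs w)
      ∩≐ = proj₂ , λ y∈ → Piece-signs-⊆ (signs x) w∈ y∈ , y∈

    induced-≐-Cell : induced (layerArrangement A) ≐ Cell
    induced-≐-Cell = to , from
      where
      to : induced (layerArrangement A) ⊆ Cell
      to {T} (C , C-component , f) = face-Cell (signs x) (IsFace-resp C̄≐ ≐-refl f)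
        where
        x = proj₁ (component-chamber C-component)
        C̄≐ : closure C ≐ Piece (signs x)
        C̄≐ = ≐-trans (closure-resp (proj₂ (component-chamber C-component))) (closure-chamber x)
      face : ∀ {T x} → x ∈ X → IsFace T (Piece (signs x)) → T ∈ induced (layerArrangement A)
      face {T} {x} x∈X f = chamber x , chamber-component x∈X ,
        IsFace-resp (≐-sym (closure-chamber x)) ≐-refl f
      from : Cell ⊆ induced (layerArrangement A)
      -- The empty set is a face of any closed chamber; the origin only serves to produce one.
      from {T} c = [ (λ T≐∅ → let x , x∈X , _ = generic (λ _ → 0#) in face x∈X (inj₁ T≐∅))
                   , (λ (w , T≐) → let x , x∈X , w∈ = generic w in
                       face x∈X (IsFace-resp ≐-refl (≐-sym T≐) (signs-face w∈))) ]′
                   (Cell-signs c)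

-- Induction on the layers of a network.

module Networks
  (em : ∀ {ℓ} → ExcludedMiddle ℓ) (𝓡 : CompleteOrderedField) where

  open Arrangements em 𝓡 public

  private
    variable
      n k p : ℕ

  -- Indexed by sign vectors instead of cells, so that the affine map is a function of `s`, as
  -- `form` in `extend` requires.
  AffineOnPieces : SignSystem n → (ℝ^ n → ℝ^ k) → Set
  AffineOnPieces {n} {k} 𝓢 f = ∀ s →
    Σ[ B ∈ AffineMap n k ] (∀ x → x ∈ Piece s → ∀ j → f x j ≈ apply B x j)
    where open SignSystem 𝓢

  AffineOnPieces⇒OnCells : (𝓢 : SignSystem n) {K : Cells n} {f : ℝ^ n → ℝ^ k} →
    K ⊆ SignSystem.Cell 𝓢 → AffineOnPieces 𝓢 f → AffineOnCells K f
  AffineOnPieces⇒OnCells 𝓢 K⊆ affine S S∈K with K⊆ S∈K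
  ... | SignSystem.empty p   = fromRows (λ _ → constantForm 0#) , λ x x∈ → ⊥-elim (proj₁ p x∈)
  ... | SignSystem.piece s p = proj₁ (affine s) , λ x x∈ → proj₂ (affine s) x (proj₁ p x∈)

  AffineOnPieces-apply : (𝓢 : SignSystem n) {f : ℝ^ n → ℝ^ k} (A : AffineMap k p) →
                         AffineOnPieces 𝓢 f → AffineOnPieces 𝓢 (apply A ∘ f)
  AffineOnPieces-apply 𝓢 A affine s =
    fromRows (λ j → pullback (row A j) (proj₁ (affine s))) , λ x x∈ j →
      trans (eval-cong (row A j) (proj₂ (affine s) x x∈))
            (sym (eval-pullback (row A j) (proj₁ (affine s)) x))

  reluForm : Sgn → AffineForm n → AffineForm n
  reluForm neg h = constantForm 0#
  reluForm zer h = constantForm 0#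
  reluForm pos h = h

  -- A weak sign suffices because the two linear branches of ReLU agree at zero.
  relu-reluForm : ∀ s (h : AffineForm n) {x a} → a ≈ eval h x → Weak s a →
                  0# ⊔ a ≈ eval (reluForm s h) x
  relu-reluForm neg h {x} {a} e p = trans ([ (λ (0≤a , q) → trans q (Weak-0≤-asym 0≤a p)) , proj₂ ]′
    (relu-cases a)) (sym (eval-constantForm 0# x))
  relu-reluForm zer h {x} {a} e p = trans ([ (λ (_ , q) → trans q p) , proj₂ ]′
    (relu-cases a)) (sym (eval-constantForm 0# x))
  relu-reluForm pos h {x} {a} e p = trans ([ proj₂ , (λ (a≤0 , q) → trans q (sym (Weak-0≤-asym p a≤0))) ]′
    (relu-cases a)) e

  -- `l` picks the labels of the newest layer; their prescribed signs select one linear branch of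
  -- each ReLU.
  AffineOnPieces-σ : (𝓢 : SignSystem n) (l : Fin k → SignSystem.Label 𝓢) →
                     AffineOnPieces 𝓢 (λ x → σ (λ j → SignSystem.φ 𝓢 (l j) x))
  AffineOnPieces-σ 𝓢 l s = fromRows (λ j → reluForm (s (l j)) (form s (l j))) , λ x x∈ j →
    relu-reluForm (s (l j)) (form s (l j)) (φ-form s x∈ (l j)) (x∈ (l j))
    where open SignSystem 𝓢

  -- Adjoins the preactivations of the next layer. The old signs determine an affine formula for
  -- `f`, so the new forms are pullbacks along it.
  extend : (𝓢 : SignSystem n) (f : ℝ^ n → ℝ^ k) → AffineOnPieces 𝓢 f →
           AffineMap k p → SignSystem n
  extend {n} {k} {p} 𝓢 f affine A = record
    { Label    = Label ⊎ Fin p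
    ; labels   = List.map inj₁ labels ++ List.map inj₂ (allFin p)
    ; complete = λ where
        (inj₁ i) → ∈-++⁺ˡ (∈-map⁺ inj₁ (complete i))
        (inj₂ l) → ∈-++⁺ʳ (List.map inj₁ labels) (∈-map⁺ inj₂ (∈-allFin l))
    ; φ        = [ φ , (λ l x → eval (row A l) (f x)) ]′
    ; form     = λ s → [ form (s ∘ inj₁) , (λ l → pullback (row A l) (B s)) ]′
    ; φ-form   = λ where
        s x∈ (inj₁ i) → φ-form (s ∘ inj₁) (x∈ ∘ inj₁) i
        s x∈ (inj₂ l) → agree s (x∈ ∘ inj₁) l
    ; cut      = λ s x∈ → λ where
        (inj₁ i) → cut (s ∘ inj₁) (x∈ ∘ inj₁) i
        -- Membership for the old labels is recovered first; only then may `f` be replaced by its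
        -- affine formula.
        (inj₂ l) → Weak-resp (s (inj₂ l)) (sym (agree s (cut (s ∘ inj₁) (x∈ ∘ inj₁)) l))
                     (x∈ (inj₂ l))
    }
    where
    open SignSystem 𝓢
    B : (Label ⊎ Fin p → Sgn) → AffineMap n k
    B s = proj₁ (affine (s ∘ inj₁))
    agree : ∀ s {x} → x ∈ Piece (s ∘ inj₁) → ∀ l →
            eval (row A l) (f x) ≈ eval (pullback (row A l) (B s)) x
    agree s {x} x∈ l = trans (eval-cong (row A l) (proj₂ (affine (s ∘ inj₁)) x x∈))
      (sym (eval-pullback (row A l) (B s) x))

  levelSetComplex-≐ : {M M′ : Cells n} {f : ℝ^ n → ℝ^ k} {R R′ : Cells k} →
    M ≐ M′ → R ≐ R′ → levelSetComplex M f R ≐ levelSetComplex M′ f R′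
  levelSetComplex-≐ (p , p′) (q , q′) =
    (λ (S , Y , S∈ , Y∈ , e) → S , Y , p S∈ , q Y∈ , e) ,
    (λ (S , Y , S∈ , Y∈ , e) → S , Y , p′ S∈ , q′ Y∈ , e)

  -- A sign vector on the extended labels is a pair of sign vectors, and its piece is the old piece
  -- intersected with the preimage of a piece of the new layer.
  levelSetComplex-extend : (𝓢 : SignSystem n) (f : ℝ^ n → ℝ^ k) (affine : AffineOnPieces 𝓢 f)
    (A : AffineMap k p) →
    levelSetComplex (SignSystem.Cell 𝓢) f (SignSystem.Cell (layerSystem A))
      ≐ SignSystem.Cell (extend 𝓢 f affine A)
  levelSetComplex-extend 𝓢 f affine A = to , from
    where
    module S = SignSystem 𝓢
    module R = SignSystem (layerSystem A)
    module E = SignSystem (extend 𝓢 f affine A)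
    to : levelSetComplex S.Cell f R.Cell ⊆ E.Cell
    to (S , Y , S.empty p , _ , e) =
      E.empty ((λ x∈ → proj₁ p (proj₁ (proj₁ e x∈))) , λ ())
    to (S , Y , S.piece s p , R.empty q , e) =
      E.empty ((λ x∈ → proj₁ q (proj₂ (proj₁ e x∈))) , λ ())
    to (S , Y , S.piece s p , R.piece t q , e) = E.piece [ s , t ]′
      ( (λ x∈ → λ where
          (inj₁ i) → proj₁ p (proj₁ (proj₁ e x∈)) i
          (inj₂ l) → proj₁ q (proj₂ (proj₁ e x∈)) l)
      , (λ x∈ → proj₂ e (proj₂ p (x∈ ∘ inj₁) , proj₂ q (x∈ ∘ inj₂))) )
    from : E.Cell ⊆ levelSetComplex S.Cell f R.Cell
    from (E.empty p) = ∅ , ∅ , S.empty ≐-refl , R.empty ≐-refl ,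
      (λ x∈ → ⊥-elim (proj₁ p x∈)) , λ ()
    from (E.piece s p) = S.Piece (s ∘ inj₁) , R.Piece (s ∘ inj₂) ,
      S.piece (s ∘ inj₁) ≐-refl , R.piece (s ∘ inj₂) ≐-refl ,
      (λ x∈ → proj₁ p x∈ ∘ inj₁ , proj₁ p x∈ ∘ inj₂) ,
      λ (x∈ , y∈) → proj₂ p λ { (inj₁ i) → x∈ i ; (inj₂ l) → y∈ l }

  module _ (F : Network) where
    open Network F

    -- The induction hypothesis on depth. `bending` marks the labels whose zero sets make up the
    -- bent hyperplanes.
    record Presentation (j : ℕ) .(j<m : j ℕ.< m) : Set₂ where
      field
        system  : SignSystem (width 0)
      open SignSystem system
      field
        cells   : complex j j<m ≐ Cell
        -- The signs of layers 0 to `j` also fix the ReLUs of layer `j`, so the composite may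
        -- include that layer.
        affine  : AffineOnPieces system (composite (suc j) j<m)
        bending : Pred Label 0ℓ
        bends   : (λ x → ∃[ i ] i ∈ bending × φ i x ≈ 0#) ≐ bentUpTo j j<m

    presentation : ∀ j .(j<m : j ℕ.< m) → Presentation j j<m
    presentation zero 0<m = record
      { system  = layerSystem (A 0 0<m)
      ; cells   = induced-≐-Cell (A 0 0<m)
      ; affine  = AffineOnPieces-σ (layerSystem (A 0 0<m)) id
      ; bending = λ l → Nondegenerate (row (A 0 0<m) l)
      ; bends   = (λ (l , nd , e) → 0 , ℕ.z≤n , (l , nd) , e) ,
                  λ { (0 , ℕ.z≤n , (l , nd) , e) → l , nd , e }
      }
    presentation (suc j) j<m = record
      { system  = extended
      ; cells   = ≐-trans (levelSetComplex-≐ cells (induced-≐-Cell (A (suc j) j<m)))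
                          (levelSetComplex-extend system _ affine (A (suc j) j<m))
      ; affine  = AffineOnPieces-σ extended inj₂
      ; bending = [ bending , (λ l → Nondegenerate (row (A (suc j) j<m) l)) ]′
      ; bends   = to , from
      }
      where
      open Presentation (presentation j (ℕ.<⇒≤ j<m))
      open SignSystem system
      extended : SignSystem (width 0)
      extended = extend system (composite (suc j) (ℕ.<⇒≤ j<m)) affine (A (suc j) j<m)
      module E = SignSystem extended
      Bends : Subset (width 0)
      Bends x = ∃[ i ] i ∈ [ bending , (λ l → Nondegenerate (row (A (suc j) j<m) l)) ]′ × E.φ i x ≈ 0#
      to : Bends ⊆ bentUpTo (suc j) j<m
      to (inj₁ i , i∈ , e) = let k , k≤j , bent = proj₁ bends (i , i∈ , e) in
        k , ℕ.m≤n⇒m≤1+n k≤j , bent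
      to (inj₂ l , nd , e) = suc j , ℕ.≤-refl , (l , nd) , e
      from : bentUpTo (suc j) j<m ⊆ Bends
      -- Either `k` is at most `j`, an earlier layer, or it is the new index `suc j`.
      from (k , k≤1+j , bent) with ℕ.m≤n⇒m<n∨m≡n k≤1+j
      from (k , k≤1+j , bent) | inj₁ k<1+j =
        let i , i∈ , e = proj₂ bends (k , ℕ.s≤s⁻¹ k<1+j , bent) in inj₁ i , i∈ , e
      from (k , k≤1+j , ((l , nd) , e)) | inj₂ ≡.refl = inj₂ l , nd , e

    composite-continuous : ∀ i .(i≤m : i ℕ.≤ m) → Continuous (composite i i≤m)
    composite-continuous zero    _   x ε 0<ε = ε , 0<ε , λ _ near → near
    composite-continuous (suc j) j<m = ∘-continuous (composite-continuous j (ℕ.<⇒≤ j<m))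
      (∘-continuous (apply-continuous (A j j<m)) σ-continuous)

    module _ (j : ℕ) (j<m : j ℕ.< m) where
      open Presentation (presentation j j<m)
      open SignSystem system

      private
        Cell-isDecomposition : IsPolyhedralDecomposition Cell
        Cell-isDecomposition = Cell-decomposition (width-pos 0 ℕ.z≤n)

      complex-decomposition : IsPolyhedralDecomposition (complex j j<m)
      complex-decomposition = decomposition-resp (≐-sym cells) Cell-isDecomposition

      composite-affine : AffineOnCells (complex j j<m) (composite (suc j) j<m)
      composite-affine = AffineOnPieces⇒OnCells system (proj₁ cells) affine

      composite-apply-affine : (B : AffineMap (width (suc j)) k) →
        AffineOnCells (complex j j<m) (apply B ∘ composite (suc j) j<m)
      composite-apply-affine B = AffineOnPieces⇒OnCells system (proj₁ cells)
        (AffineOnPieces-apply system B affine)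

      bent-subcomplex : Σ[ L ∈ Cells (width 0) ]
        (IsSubcomplex L (complex j j<m) × domain L ≐ bentUpTo j j<m)
      bent-subcomplex = VanishingCell bending ,
        ( (λ c → proj₂ cells (proj₁ c))
        , VanishingCell-faceClosed bending
            (IsPolyhedralComplex.faceClosed (proj₁ Cell-isDecomposition)) ) ,
        ≐-trans (VanishingCell-domain bending) bends

theorem1 : (∀ {ℓ} → ExcludedMiddle ℓ) →
    (𝓡 : CompleteOrderedField) → let open Euclidean 𝓡 in
    (F : Network) → let open Network F in
    (∀ j (j<m : j ℕ.< m) →
    IsPolyhedralDecomposition (complex j j<m) ×
    AffineOnCells (complex j j<m) (composite (suc j) j<m) ×
    (Σ[ L ∈ Cells (width 0) ]
    (IsSubcomplex L (complex j j<m) × domain L ≐ bentUpTo j j<m))) ×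
    Continuous network ×
    IsPolyhedralDecomposition canonicalComplex ×
    AffineOnCells canonicalComplex network
theorem1 em 𝓡 F =
  (λ j j<m → complex-decomposition F j j<m , composite-affine F j j<m , bent-subcomplex F j j<m) ,
  ∘-continuous (composite-continuous F m ℕ.≤-refl) (apply-continuous G) ,
  -- Counting from zero, the last of the m = suc d hidden layers has index `d`.
  complex-decomposition F d ℕ.≤-refl ,
  composite-apply-affine F d ℕ.≤-refl G
  where
  open Networks em 𝓡
  open Euclidean.Network F
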